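{- Let $p$ be a prime and let $Q \in \mathbb{Z}[x]$ be a monic polynomial of degree $d \geq 2$ that is irreducible over $\mathbb{Z}_p$. Let $\alpha \geq 0$ be the largest non-negative integer such that $Q(x) \equiv 0 \mod p^{\alpha}$ for some $x \in \mathbb{Z}$. Then the sequence $V_p(Q) = \{\nu_p(Q(n)) : n \in \mathbb{N}\}$ is periodic with period length $p^{\lceil \alpha/d \rceil}$.
   Context: $\mathbb{N} = \{0,1,2,\dots\}$. For a prime $p$ and a nonzero integer $m$, $\nu_p(m)$ is the exponent of the highest power of $p$ dividing $m$. $\mathbb{Z}_p$ is the ring of $p$-adic integers; "irreducible over $\mathbb{Z}_p$" means irreducible in $\mathbb{Z}_p[x]$. "Period length" means the minimal period length: the least integer $T \geq 1$ such that $\nu_p(Q(n+T)) = \nu_p(Q(n))$ for all $n \in \mathbb{N}$. -}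

module Defs where

open import Algebra.Bundles using (RawSemiring)
open import Algebra.Definitions.RawSemiring using (Irreducible)
open import Data.Integer.Base as ℤ using (ℤ; +_; 0ℤ; 1ℤ; ∣_∣)
import Data.Integer.Divisibility.Signed as ℤ
import Data.Integer.Properties as ℤ
open import Data.Integer.Tactic.RingSolver using (solve-∀)
open import Data.List.Base using (List; []; _∷_; map)
open import Data.Nat.Base using (ℕ; zero; suc; _+_; _^_; _≤_; _<_; z≤n; s≤s; NonZero)
open import Data.Nat.Divisibility using (_∣_; _∣?_; 1∣_; ∣⇒≤)
open import Data.Nat.Primality using (Prime; prime⇒nonTrivial)
import Data.Nat.Base as ℕ
open import Data.Nat.Properties using (≤-trans; <⇒≤; ^-monoʳ-<; m≤n⇒m<n∨m≡n; ≤-pred; ≤-refl)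
open import Data.Product.Base using (_×_; _,_; ∃-syntax)
import Data.Rational.Unnormalised.Base as ℚᵘ
open import Data.Sum.Base using (inj₁; inj₂)
open import Level using (_⊔_; 0ℓ)
open import Relation.Binary.PropositionalEquality using (_≡_; refl; subst)
open import Relation.Nullary.Decidable using (yes; no)
open import Relation.Nullary.Negation using (contradiction)
open import Relation.Unary using (Pred; Decidable)

-- Lists of coefficients, constant term first.  Trailing zeros are allowed, so
-- equality is equality of all coefficients.
module Polynomial {c ℓ} (R : RawSemiring c ℓ) where
  open RawSemiring R
    renaming (Carrier to A; _+_ to _+ᴿ_; _*_ to _*ᴿ_)

  Poly : Set c
  Poly = List A

  coeff : Poly → ℕ → A
  coeff []      _       = 0#
  coeff (a ∷ f) zero    = a
  coeff (a ∷ f) (suc i) = coeff f i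

  infix 4 _≈ₚ_
  _≈ₚ_ : Poly → Poly → Set ℓ
  f ≈ₚ g = ∀ i → coeff f i ≈ coeff g i

  infixl 6 _+ₚ_
  _+ₚ_ : Poly → Poly → Poly
  []      +ₚ g       = g
  (a ∷ f) +ₚ []      = a ∷ f
  (a ∷ f) +ₚ (b ∷ g) = (a +ᴿ b) ∷ (f +ₚ g)

  infixl 7 _*ₚ_
  _*ₚ_ : Poly → Poly → Poly
  []      *ₚ g = []
  (a ∷ f) *ₚ g = map (a *ᴿ_) g +ₚ (0# ∷ f *ₚ g)

  polyRawSemiring : RawSemiring c ℓ
  polyRawSemiring = record
    { Carrier = Poly
    ; _≈_     = _≈ₚ_
    ; _+_     = _+ₚ_
    ; _*_     = _*ₚ_
    ; 0#      = []
    ; 1#      = 1# ∷ []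
    }

  eval : Poly → A → A
  eval []      x = 0#
  eval (a ∷ f) x = a +ᴿ x *ᴿ eval f x

  MonicOfDegree : ℕ → Poly → Set ℓ
  MonicOfDegree d f = coeff f d ≈ 1# × (∀ i → d < i → coeff f i ≈ 0#)

open Polynomial ℤ.+-*-rawSemiring public using (eval; MonicOfDegree)

ℤ[x] : Set
ℤ[x] = Polynomial.Poly ℤ.+-*-rawSemiring

infix 4 _≡_[mod_]
_≡_[mod_] : ℤ → ℤ → ℕ → Set
x ≡ y [mod m ] = + m ℤ.∣ x ℤ.- y

≡-mod-refl : ∀ {m} x → x ≡ x [mod m ]
≡-mod-refl x = ℤ.divides 0ℤ (ℤ.+-inverseʳ x)

+-cong-mod : ∀ {m} x′ x y′ y → x′ ≡ x [mod m ] → y′ ≡ y [mod m ] →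
             x′ ℤ.+ y′ ≡ x ℤ.+ y [mod m ]
+-cong-mod {m} x′ x y′ y p q =
  subst (+ m ℤ.∣_) (eq x y x′ y′) (ℤ.∣m∣n⇒∣m+n p q)
  where
  eq : ∀ x y x′ y′ → (x′ ℤ.- x) ℤ.+ (y′ ℤ.- y) ≡ (x′ ℤ.+ y′) ℤ.- (x ℤ.+ y)
  eq = solve-∀

*-cong-mod : ∀ {m} x′ x y′ y → x′ ≡ x [mod m ] → y′ ≡ y [mod m ] →
             x′ ℤ.* y′ ≡ x ℤ.* y [mod m ]
*-cong-mod {m} x′ x y′ y p q =
  subst (+ m ℤ.∣_) (eq x y x′ y′)
    (ℤ.∣m∣n⇒∣m+n (ℤ.∣m⇒∣m*n y′ p) (ℤ.∣n⇒∣m*n x q))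
  where
  eq : ∀ x y x′ y′ →
       (x′ ℤ.- x) ℤ.* y′ ℤ.+ x ℤ.* (y′ ℤ.- y) ≡ x′ ℤ.* y′ ℤ.- x ℤ.* y
  eq = solve-∀

-- The p-adic integers as the inverse limit of the rings ℤ/pᵏ: `approx k` is an
-- integer representing the residue modulo pᵏ.
record ℤ[_]-adic (p : ℕ) : Set where
  constructor mkℤₚ
  field
    approx   : ℕ → ℤ
    coherent : ∀ k → approx (suc k) ≡ approx k [mod p ^ k ]

open ℤ[_]-adic public

module _ (p : ℕ) where

  fromℤ : ℤ → ℤ[ p ]-adic
  fromℤ m = mkℤₚ (λ _ → m) (λ _ → ≡-mod-refl m)

  ℤₚ-rawSemiring : RawSemiring 0ℓ 0ℓ
  ℤₚ-rawSemiring = record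
    { Carrier = ℤ[ p ]-adic
    ; _≈_     = λ a b → ∀ k → approx a k ≡ approx b k [mod p ^ k ]
    ; _+_     = λ a b → mkℤₚ (λ k → approx a k ℤ.+ approx b k)
        (λ k → +-cong-mod (approx a (suc k)) (approx a k) (approx b (suc k)) (approx b k)
                 (coherent a k) (coherent b k))
    ; _*_     = λ a b → mkℤₚ (λ k → approx a k ℤ.* approx b k)
        (λ k → *-cong-mod (approx a (suc k)) (approx a k) (approx b (suc k)) (approx b k)
                 (coherent a k) (coherent b k))
    ; 0#      = fromℤ 0ℤ
    ; 1#      = fromℤ 1ℤ
    }

  IrreducibleOverℤₚ : ℤ[x] → Set
  IrreducibleOverℤₚ Q =
    Irreducible (Polynomial.polyRawSemiring ℤₚ-rawSemiring) (map fromℤ Q)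

-- The largest v ≤ b satisfying P (and 0 if there is none).
largest≤ : ∀ {ℓ} {P : Pred ℕ ℓ} → Decidable P → ℕ → ℕ
largest≤ P? zero    = zero
largest≤ P? (suc b) with P? (suc b)
... | yes _ = suc b
... | no  _ = largest≤ P? b

-- For p ≥ 2 the search may stop at ∣ m ∣, since v < pᵛ ≤ ∣ m ∣ if pᵛ divides m;
-- see ν-divides and ν-maximal.
ν : (p : ℕ) (m : ℤ) .{{_ : ℤ.NonZero m}} → ℕ
ν p m = largest≤ (λ v → p ^ v ∣? ∣ m ∣) ∣ m ∣

module _ {ℓ} {P : Pred ℕ ℓ} (P? : Decidable P) where

  largest≤-sat : P 0 → ∀ b → P (largest≤ P? b)
  largest≤-sat P0 zero    = P0
  largest≤-sat P0 (suc b) with P? (suc b)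
  ... | yes Pb = Pb
  ... | no  _  = largest≤-sat P0 b

  largest≤-max : ∀ b {v} → v ≤ b → P v → v ≤ largest≤ P? b
  largest≤-max zero    v≤b Pv = v≤b
  largest≤-max (suc b) v≤b Pv with P? (suc b) | m≤n⇒m<n∨m≡n v≤b
  ... | yes _  | _         = v≤b
  ... | no  _  | inj₁ v<sb = largest≤-max b (≤-pred v<sb) Pv
  ... | no ¬Pb | inj₂ refl = contradiction Pv ¬Pb

ν-divides : ∀ p m .{{_ : ℤ.NonZero m}} → p ^ ν p m ∣ ∣ m ∣
ν-divides p m = largest≤-sat (λ v → p ^ v ∣? ∣ m ∣) (1∣ ∣ m ∣) ∣ m ∣

ν-maximal : ∀ {p} → Prime p → ∀ m .{{_ : ℤ.NonZero m}} {v} →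
            p ^ v ∣ ∣ m ∣ → v ≤ ν p m
ν-maximal {p} pr m {v} pᵛ∣m =
  largest≤-max (λ v → p ^ v ∣? ∣ m ∣) ∣ m ∣
    (≤-trans (<⇒≤ (n<pⁿ v)) (∣⇒≤ pᵛ∣m)) pᵛ∣m
  where
  n<pⁿ : ∀ n → n < p ^ n
  n<pⁿ zero    = s≤s z≤n
  n<pⁿ (suc n) = ≤-trans (s≤s (n<pⁿ n))
    (^-monoʳ-< p (ℕ.nonTrivial⇒n>1 p {{prime⇒nonTrivial pr}}) {n} ≤-refl)

IsLargest : ∀ {ℓ} → Pred ℕ ℓ → ℕ → Set ℓ
IsLargest P a = P a × (∀ b → P b → b ≤ a)

HasRootMod : ℤ[x] → ℕ → Set
HasRootMod Q m = ∃[ x ] eval Q x ≡ 0ℤ [mod m ]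

IsPeriod : (ℕ → ℕ) → ℕ → Set
IsPeriod f T = 1 ≤ T × (∀ n → f (n + T) ≡ f n)

IsPeriodLength : (ℕ → ℕ) → ℕ → Set
IsPeriodLength f T = IsPeriod f T × (∀ S → IsPeriod f S → T ≤ S)

-- A ceiling of a non-negative rational, so ∣_∣ only changes its type to ℕ.
⌈_/_⌉ : (a d : ℕ) .{{_ : NonZero d}} → ℕ
⌈ a / d ⌉ = ∣ ℚᵘ.ceiling (+ a ℚᵘ./ d) ∣

{-# OPTIONS --safe #-}
module Submission where

open import Defs
open import Data.Integer.Base using (+_; NonZero)
open import Data.Nat.Base using (ℕ; _≤_; _^_; >-nonZero)
open import Data.Nat.Primality using (Prime)
open import Data.Nat.Properties using (<⇒≤)
open import Data.Product.Base using (Σ-syntax)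

open import Algebra.Bundles using (RawSemiring)
import Algebra.Definitions.RawMagma as RM
import Algebra.Definitions.RawSemiring as RS
open import Data.Integer.Base as ℤ using (ℤ; 0ℤ; 1ℤ)
import Data.Integer.Divisibility.Signed as ℤ
import Data.Integer.DivMod as ℤ
import Data.Integer.Properties as ℤ
open import Data.Integer.Tactic.RingSolver using (solve-∀)
import Data.Nat.Tactic.RingSolver as ℕ-Solver
open import Data.List.Base using ([]; _∷_; length; map; applyUpTo)
open import Data.Nat.Base as ℕ using (zero; suc; _+_; _*_; _<_; z≤n; s≤s)
open import Data.Nat.Coprimality using (Coprime; coprime-Bézout)
import Data.Nat.Divisibility as ℕ
open import Data.Nat.GCD using (module Bézout)
open import Data.Nat.Primality
  using (euclidsLemma; prime⇒irreducible; prime⇒nonTrivial; prime⇒nonZero)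
import Data.Nat.Properties as ℕ
open import Data.Product.Base using (_×_; _,_; proj₁; proj₂; ∃-syntax)
import Data.Rational.Unnormalised.Base as ℚᵘ
open import Data.Sum.Base using (_⊎_; inj₁; inj₂)
open import Function.Base using (_∘_)
open import Relation.Binary.PropositionalEquality
  using (_≡_; _≗_; refl; sym; trans; cong; cong₂; subst; subst₂; module ≡-Reasoning)
open import Relation.Nullary.Decidable using (Dec; yes; no; _×-dec_)
open import Relation.Nullary.Negation using (¬_; contradiction)

-- Let x be an integer at which ν(Q) attains its maximum α, and let F(y) = Q(x + y), so
-- that ν(F(0)) = α.  If the Newton polygon of F had a vertex strictly between its end
-- points (0 , α) and (d , 0), Hensel lifting would factor F, hence Q, over ℤₚ.  So the
-- polygon is the segment joining them, that is, d ν(Fᵢ) ≥ α (d - i) for all i.  Therefore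
-- ν(F(y)) = d ν(y) if d ν(y) < α, and otherwise ν(F(y)) ≥ α, with equality by the choice
-- of α.  The valuation of F(y) thus depends on y modulo pᵏ with k = ⌈ α / d ⌉, and y
-- attains the maximum exactly when pᵏ divides y.

-- Polynomials as coefficient functions

-- The step that needs care is the factorization at a vertex. All roots involved may have positive
-- valuation, so the two factors need not be coprime modulo `p` and the usual form of Hensel's lemma
-- does not apply. It is replaced by lifting with respect to the integer weight `a i + b ν(Fᵢ)`,
-- where `- a / b` is the slope of a supporting line (in the application `a = α` and `b = d`, not
-- reduced). If `(J , s)` is the last point of `F` on that line, the part of `F` of least weight is
-- `u pˢ` times a form with leading term `x^J`, with `u` prime to `p`. Up to higher weight the
-- cofactor `H` is thus the constant `u pˢ`, and dividing by it only requires dividing by `pˢ` and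
-- inverting `u` modulo `p`. Each round gains one unit of weight. As the positions `i` are bounded
-- by the degree, growing weight forces growing valuation, so the rounds converge p-adically. They
-- all take place among integer polynomials; p-adic integers appear only when the limit is
-- confronted with irreducibility.

Series : Set
Series = ℕ → ℤ

Deg< : ℕ → Series → Set
Deg< n f = ∀ i → n ≤ i → f i ≡ 0ℤ

Monic : ℕ → Series → Set
Monic n f = f n ≡ 1ℤ × Deg< (suc n) f

infixr 5 _∷ˢ_
_∷ˢ_ : ℤ → Series → Series
(a ∷ˢ f) zero    = a
(a ∷ˢ f) (suc i) = f i

infixl 6 _⊕_
_⊕_ : Series → Series → Series
(f ⊕ g) i = f i ℤ.+ g i

infixl 8 _·_
_·_ : ℤ → Series → Series
(c · f) i = c ℤ.* f i

infixl 7 _⊛_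
_⊛_ : Series → Series → Series
(f ⊛ g) zero    = f 0 ℤ.* g 0
(f ⊛ g) (suc n) = f 0 ℤ.* g (suc n) ℤ.+ ((f ∘ suc) ⊛ g) n

x+0 : ∀ {x y} → y ≡ 0ℤ → x ℤ.+ y ≡ x
x+0 refl = ℤ.+-identityʳ _

zero-+ : ∀ {x y} → x ≡ 0ℤ → y ≡ 0ℤ → x ℤ.+ y ≡ 0ℤ
zero-+ refl refl = refl

zero-*ˡ : ∀ {x} y → x ≡ 0ℤ → x ℤ.* y ≡ 0ℤ
zero-*ˡ y refl = ℤ.*-zeroˡ y

zero-*ʳ : ∀ x {y} → y ≡ 0ℤ → x ℤ.* y ≡ 0ℤ
zero-*ʳ x refl = ℤ.*-zeroʳ x

-- The common induction behind the degree, divisibility and weight bounds for products: `P` is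
-- instantiated to vanishing, to divisibility by a fixed integer and to `Val`.
⊛-closed : (P : ℤ → Set) → (∀ {x y} → P x → P y → P (x ℤ.+ y)) → ∀ n f g →
           (∀ i k → i + k ≡ n → P (f i ℤ.* g k)) → P ((f ⊛ g) n)
⊛-closed P P-+ zero    f g h = h 0 0 refl
⊛-closed P P-+ (suc n) f g h =
  P-+ (h 0 (suc n) refl)
      (⊛-closed P P-+ n (f ∘ suc) g (λ i k eq → h (suc i) k (cong suc eq)))

⊛-zeroˡ : ∀ {f} → (∀ i → f i ≡ 0ℤ) → ∀ g n → (f ⊛ g) n ≡ 0ℤ
⊛-zeroˡ f≡0 g n = ⊛-closed (_≡ 0ℤ) zero-+ n _ g (λ i k _ → zero-*ˡ (g k) (f≡0 i))

⊛-cong : ∀ {f f′ g g′} → f ≗ f′ → g ≗ g′ → f ⊛ g ≗ f′ ⊛ g′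
⊛-cong p q zero    = cong₂ ℤ._*_ (p 0) (q 0)
⊛-cong p q (suc n) =
  cong₂ ℤ._+_ (cong₂ ℤ._*_ (p 0) (q (suc n))) (⊛-cong (p ∘ suc) q n)

⊛-distribʳ : ∀ f f′ g → (f ⊕ f′) ⊛ g ≗ f ⊛ g ⊕ f′ ⊛ g
⊛-distribʳ f f′ g zero    = ℤ.*-distribʳ-+ (g 0) (f 0) (f′ 0)
⊛-distribʳ f f′ g (suc n) rewrite ⊛-distribʳ (f ∘ suc) (f′ ∘ suc) g n =
  eq (f 0) (f′ 0) (g (suc n)) (((f ∘ suc) ⊛ g) n) (((f′ ∘ suc) ⊛ g) n)
  where
  eq : ∀ a a′ b c c′ → (a ℤ.+ a′) ℤ.* b ℤ.+ (c ℤ.+ c′) ≡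
                       (a ℤ.* b ℤ.+ c) ℤ.+ (a′ ℤ.* b ℤ.+ c′)
  eq = solve-∀

⊛-distribˡ : ∀ f g g′ → f ⊛ (g ⊕ g′) ≗ f ⊛ g ⊕ f ⊛ g′
⊛-distribˡ f g g′ zero    = ℤ.*-distribˡ-+ (f 0) (g 0) (g′ 0)
⊛-distribˡ f g g′ (suc n) rewrite ⊛-distribˡ (f ∘ suc) g g′ n =
  eq (f 0) (g (suc n)) (g′ (suc n)) (((f ∘ suc) ⊛ g) n) (((f ∘ suc) ⊛ g′) n)
  where
  eq : ∀ a b b′ c c′ → a ℤ.* (b ℤ.+ b′) ℤ.+ (c ℤ.+ c′) ≡
                       (a ℤ.* b ℤ.+ c) ℤ.+ (a ℤ.* b′ ℤ.+ c′)
  eq = solve-∀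

⊛-scaleˡ : ∀ c f g → (c · f) ⊛ g ≗ c · (f ⊛ g)
⊛-scaleˡ c f g zero    = ℤ.*-assoc c (f 0) (g 0)
⊛-scaleˡ c f g (suc n) rewrite ⊛-scaleˡ c (f ∘ suc) g n =
  eq c (f 0) (g (suc n)) (((f ∘ suc) ⊛ g) n)
  where
  eq : ∀ c a b x → c ℤ.* a ℤ.* b ℤ.+ c ℤ.* x ≡ c ℤ.* (a ℤ.* b ℤ.+ x)
  eq = solve-∀

⊛-constˡ : ∀ c g → (c ∷ˢ λ _ → 0ℤ) ⊛ g ≗ c · g
⊛-constˡ c g zero    = refl
⊛-constˡ c g (suc n) = x+0 (⊛-zeroˡ (λ _ → refl) g n)

⊛-deg : ∀ {m n f g} → Deg< (suc m) f → Deg< n g → Deg< (m + n) (f ⊛ g)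
⊛-deg {m} {n} {f} {g} f< g< i m+n≤i =
  ⊛-closed (_≡ 0ℤ) zero-+ i f g helper
  where
  helper : ∀ x y → x + y ≡ i → f x ℤ.* g y ≡ 0ℤ
  helper x y x+y≡i with ℕ.<-≤-connex m x
  ... | inj₁ m<x = zero-*ˡ (g y) (f< x m<x)
  ... | inj₂ x≤m = zero-*ʳ (f x) (g< y (ℕ.+-cancelˡ-≤ m n y
          (ℕ.≤-trans m+n≤i (ℕ.≤-trans (ℕ.≤-reflexive (sym x+y≡i)) (ℕ.+-monoˡ-≤ y x≤m)))))

-- T c n f is f (x + c) when f has degree less than n.
T : ℤ → ℕ → Series → Series
T c zero    f = λ _ → 0ℤ
T c (suc n) f = (f 0 ∷ˢ T c n (f ∘ suc)) ⊕ c · T c n (f ∘ suc)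

T-closed : (P : ℤ → Set) → P 0ℤ → (∀ {x y} → P x → P y → P (x ℤ.+ y)) →
           (∀ c {x} → P x → P (c ℤ.* x)) →
           ∀ c n {f} → (∀ i → P (f i)) → ∀ i → P (T c n f i)
T-closed P P0 P+ P* c zero    Pf i       = P0
T-closed P P0 P+ P* c (suc n) Pf zero    = P+ (Pf 0) (P* c (T-closed P P0 P+ P* c n (Pf ∘ suc) 0))
T-closed P P0 P+ P* c (suc n) Pf (suc i) =
  P+ (T-closed P P0 P+ P* c n (Pf ∘ suc) i) (P* c (T-closed P P0 P+ P* c n (Pf ∘ suc) (suc i)))

T-zero : ∀ c n {f} → (∀ i → f i ≡ 0ℤ) → ∀ i → T c n f i ≡ 0ℤ
T-zero = T-closed (_≡ 0ℤ) refl zero-+ zero-*ʳ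

T-cong : ∀ c n {f g} → f ≗ g → T c n f ≗ T c n g
T-cong c zero    p i       = refl
T-cong c (suc n) p zero    = cong₂ ℤ._+_ (p 0) (cong (c ℤ.*_) (T-cong c n (p ∘ suc) 0))
T-cong c (suc n) p (suc i) =
  cong₂ ℤ._+_ (T-cong c n (p ∘ suc) i) (cong (c ℤ.*_) (T-cong c n (p ∘ suc) (suc i)))

T-⊕ : ∀ c n f g → T c n (f ⊕ g) ≗ T c n f ⊕ T c n g
T-⊕ c zero    f g i       = refl
T-⊕ c (suc n) f g zero    rewrite T-⊕ c n (f ∘ suc) (g ∘ suc) 0 =
  eq c (f 0) (g 0) (T c n (f ∘ suc) 0) (T c n (g ∘ suc) 0)
  where
  eq : ∀ c x y u v → (x ℤ.+ y) ℤ.+ c ℤ.* (u ℤ.+ v) ≡ (x ℤ.+ c ℤ.* u) ℤ.+ (y ℤ.+ c ℤ.* v)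
  eq = solve-∀
T-⊕ c (suc n) f g (suc i)
  rewrite T-⊕ c n (f ∘ suc) (g ∘ suc) i | T-⊕ c n (f ∘ suc) (g ∘ suc) (suc i) =
  eq c (T c n (f ∘ suc) i) (T c n (g ∘ suc) i) (T c n (f ∘ suc) (suc i)) (T c n (g ∘ suc) (suc i))
  where
  eq : ∀ c x y u v → (x ℤ.+ y) ℤ.+ c ℤ.* (u ℤ.+ v) ≡ (x ℤ.+ c ℤ.* u) ℤ.+ (y ℤ.+ c ℤ.* v)
  eq = solve-∀

T-· : ∀ c n k f → T c n (k · f) ≗ k · T c n f
T-· c zero    k f i       = sym (ℤ.*-zeroʳ k)
T-· c (suc n) k f zero    rewrite T-· c n k (f ∘ suc) 0 = eq c k (f 0) (T c n (f ∘ suc) 0)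
  where
  eq : ∀ c k x u → k ℤ.* x ℤ.+ c ℤ.* (k ℤ.* u) ≡ k ℤ.* (x ℤ.+ c ℤ.* u)
  eq = solve-∀
T-· c (suc n) k f (suc i) rewrite T-· c n k (f ∘ suc) i | T-· c n k (f ∘ suc) (suc i) =
  eq c k (T c n (f ∘ suc) i) (T c n (f ∘ suc) (suc i))
  where
  eq : ∀ c k x u → k ℤ.* x ℤ.+ c ℤ.* (k ℤ.* u) ≡ k ℤ.* (x ℤ.+ c ℤ.* u)
  eq = solve-∀

T-deg : ∀ c n f → Deg< n (T c n f)
T-deg c zero    f i       _         = refl
T-deg c (suc n) f (suc i) (s≤s n≤i) =
  zero-+ (T-deg c n (f ∘ suc) i n≤i) (zero-*ʳ c (T-deg c n (f ∘ suc) (suc i) (ℕ.m≤n⇒m≤1+n n≤i)))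

T-extend : ∀ c {m n} → m ≤ n → ∀ {f} → Deg< m f → T c n f ≗ T c m f
T-extend c {n = n} z≤n f< i = T-zero c n (λ k → f< k z≤n) i
T-extend c (s≤s m≤n) {f} f< zero    =
  cong (λ z → f 0 ℤ.+ c ℤ.* z) (T-extend c m≤n (λ k → f< (suc k) ∘ s≤s) 0)
T-extend c (s≤s m≤n) {f} f< (suc i) =
  cong₂ (λ y z → y ℤ.+ c ℤ.* z) (T-extend c m≤n (λ k → f< (suc k) ∘ s≤s) i)
                                (T-extend c m≤n (λ k → f< (suc k) ∘ s≤s) (suc i))

-- A list of coefficients may have trailing zeros, so evaluation yields the bound `length Q` where
-- the rest of the proof has `suc d`; this reconciles the two.
T-size : ∀ c {m n} {f} → Deg< m f → Deg< n f → T c m f ≗ T c n f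
T-size c {m} {n} f<m f<n i with ℕ.≤-total m n
... | inj₁ m≤n = sym (T-extend c m≤n f<m i)
... | inj₂ n≤m = T-extend c n≤m f<n i

T-lead : ∀ c n f → T c (suc n) f n ≡ f n
T-lead c zero    f = x+0 (ℤ.*-zeroʳ c)
T-lead c (suc n) f =
  trans (x+0 (zero-*ʳ c (T-deg c (suc n) (f ∘ suc) (suc n) ℕ.≤-refl))) (T-lead c n (f ∘ suc))

T-monic : ∀ c {n f} → Monic n f → Monic n (T c (suc n) f)
T-monic c {n} {f} (fn , f<) = trans (T-lead c n f) fn , T-deg c (suc n) f

-- Write `f = f 0 + x f₁`. With `P` and `M` the translates of `f₁` and `g`, both sides equal
-- `f 0 M + (x + c) P M`, the product `P M` being given by induction.
T-⊛ : ∀ c n m {f g} → Deg< n f → Deg< m g → T c (n + m) (f ⊛ g) ≗ T c n f ⊛ T c m g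
T-⊛ c zero    m {f} {g} f< g< i =
  trans (T-zero c m (⊛-zeroˡ (λ k → f< k z≤n) g) i) (sym (⊛-zeroˡ (λ _ → refl) (T c m g) i))
T-⊛ c (suc n) m {f} {g} f< g< i =
  trans (cong₂ ℤ._+_ (∷ˢ-cong i) (cong (c ℤ.*_) (A≗ i)))
  (trans (rearrange i)
  (trans (cong₂ (λ y z → y ℤ.+ c ℤ.* z) (cong₂ ℤ._+_ (cong (f 0 ℤ.*_) (M≗ i)) refl) refl)
  (sym (trans (⊛-distribʳ (f 0 ∷ˢ P) (c · P) M i)
              (cong₂ ℤ._+_ (∷ˢ-⊛ i) (⊛-scaleˡ c P M i))))))
  where
  P = T c n (f ∘ suc)
  M = T c m g
  A = T c (n + m) ((f ⊛ g) ∘ suc)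
  B = T c (n + m) (g ∘ suc)
  C = P ⊛ M
  A≗ : A ≗ f 0 · B ⊕ C
  A≗ k = trans (T-⊕ c (n + m) (f 0 · (g ∘ suc)) ((f ∘ suc) ⊛ g) k)
    (cong₂ ℤ._+_ (T-· c (n + m) (f 0) (g ∘ suc) k) (T-⊛ c n m (λ k → f< (suc k) ∘ s≤s) g< k))
  ∷ˢ-cong : (f 0 ℤ.* g 0) ∷ˢ A ≗ (f 0 ℤ.* g 0) ∷ˢ (f 0 · B ⊕ C)
  ∷ˢ-cong zero    = refl
  ∷ˢ-cong (suc k) = A≗ k
  M≗ : (g 0 ∷ˢ B) ⊕ c · B ≗ M
  M≗ = T-extend c (ℕ.m≤n⇒m≤1+n (ℕ.m≤n+m m n)) g<
  ∷ˢ-⊛ : (f 0 ∷ˢ P) ⊛ M ≗ f 0 · M ⊕ (0ℤ ∷ˢ C)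
  ∷ˢ-⊛ zero    = sym (ℤ.+-identityʳ _)
  ∷ˢ-⊛ (suc k) = refl
  rearrange : ((f 0 ℤ.* g 0) ∷ˢ (f 0 · B ⊕ C)) ⊕ c · (f 0 · B ⊕ C) ≗
              (f 0 · ((g 0 ∷ˢ B) ⊕ c · B) ⊕ (0ℤ ∷ˢ C)) ⊕ c · C
  rearrange zero    = eq (f 0) (g 0) (B 0) (C 0) c
    where
    eq : ∀ x y b z c → x ℤ.* y ℤ.+ c ℤ.* (x ℤ.* b ℤ.+ z) ≡
                       (x ℤ.* (y ℤ.+ c ℤ.* b) ℤ.+ 0ℤ) ℤ.+ c ℤ.* z
    eq = solve-∀
  rearrange (suc k) = eq (f 0) (B k) (B (suc k)) (C k) (C (suc k)) c
    where
    eq : ∀ x b b′ z z′ c → (x ℤ.* b ℤ.+ z) ℤ.+ c ℤ.* (x ℤ.* b′ ℤ.+ z′) ≡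
                           (x ℤ.* (b ℤ.+ c ℤ.* b′) ℤ.+ z) ℤ.+ c ℤ.* z′
    eq = solve-∀

-- Evaluation is the constant coefficient of a translate, so this also yields `Q(n₀ + y) = F(y)` for
-- the translate `F` of `Q` by `n₀`.
T-∘ : ∀ y c n f → T y n (T c n f) ≗ T (c ℤ.+ y) n f
T-∘ y c zero    f i = refl
T-∘ y c (suc n) f i = begin
  T y (suc n) ((f 0 ∷ˢ g) ⊕ c · g) i
    ≡⟨ T-⊕ y (suc n) (f 0 ∷ˢ g) (c · g) i ⟩
  T y (suc n) (f 0 ∷ˢ g) i ℤ.+ T y (suc n) (c · g) i
    ≡⟨ cong (λ z → T y (suc n) (f 0 ∷ˢ g) i ℤ.+ z) (T-· y (suc n) c g i) ⟩
  T y (suc n) (f 0 ∷ˢ g) i ℤ.+ c ℤ.* T y (suc n) g i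
    ≡⟨ cong (λ z → T y (suc n) (f 0 ∷ˢ g) i ℤ.+ c ℤ.* z)
         (T-extend y (ℕ.n≤1+n n) (T-deg c n (f ∘ suc)) i) ⟩
  ((f 0 ∷ˢ T y n g) i ℤ.+ y ℤ.* T y n g i) ℤ.+ c ℤ.* T y n g i
    ≡⟨ eq ((f 0 ∷ˢ T y n g) i) y c (T y n g i) ⟩
  (f 0 ∷ˢ T y n g) i ℤ.+ (c ℤ.+ y) ℤ.* T y n g i
    ≡⟨ cong₂ (λ u v → u ℤ.+ (c ℤ.+ y) ℤ.* v) (∷ˢ-cong i) (T-∘ y c n (f ∘ suc) i) ⟩
  T (c ℤ.+ y) (suc n) f i ∎
  where
  open ≡-Reasoning
  g = T c n (f ∘ suc)
  ∷ˢ-cong : f 0 ∷ˢ T y n g ≗ f 0 ∷ˢ T (c ℤ.+ y) n (f ∘ suc)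
  ∷ˢ-cong zero    = refl
  ∷ˢ-cong (suc k) = T-∘ y c n (f ∘ suc) k
  eq : ∀ x y c z → (x ℤ.+ y ℤ.* z) ℤ.+ c ℤ.* z ≡ x ℤ.+ (c ℤ.+ y) ℤ.* z
  eq = solve-∀

T-id : ∀ n {f} → Deg< n f → T 0ℤ n f ≗ f
T-id zero    f< i       = sym (f< i z≤n)
T-id (suc n) f< zero    = x+0 refl
T-id (suc n) f< (suc i) = trans (x+0 refl) (T-id n (λ k → f< (suc k) ∘ s≤s) i)

T-inverse : ∀ c n {f} → Deg< n f → T (ℤ.- c) n (T c n f) ≗ f
T-inverse c n {f} f< i =
  trans (T-∘ (ℤ.- c) c n f i)
        (trans (cong (λ z → T z n f i) (ℤ.+-inverseʳ c)) (T-id n f< i))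

-- The Horner recursion removes the constant coefficient. Removing the leading one instead exposes
-- the terms `yⁱ fᵢ`, on which the estimates of values rest.
T-last : ∀ y n f → T y (suc n) f 0 ≡ T y n f 0 ℤ.+ y ℤ.^ n ℤ.* f n
T-last y zero    f = eq y (f 0)
  where
  eq : ∀ y x → x ℤ.+ y ℤ.* 0ℤ ≡ 0ℤ ℤ.+ 1ℤ ℤ.* x
  eq = solve-∀
T-last y (suc n) f rewrite T-last y n (f ∘ suc) =
  eq y (f 0) (T y n (f ∘ suc) 0) (y ℤ.^ n) (f (suc n))
  where
  eq : ∀ y a t z x → a ℤ.+ y ℤ.* (t ℤ.+ z ℤ.* x) ≡ (a ℤ.+ y ℤ.* t) ℤ.+ y ℤ.* z ℤ.* x
  eq = solve-∀

value-closed : (P : ℤ → Set) → P 0ℤ → (∀ {u v} → P u → P v → P (u ℤ.+ v)) →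
               ∀ y n f → (∀ i → i < n → P (y ℤ.^ i ℤ.* f i)) → P (T y n f 0)
value-closed P P0 P+ y zero    f h = P0
value-closed P P0 P+ y (suc n) f h =
  subst P (sym (T-last y n f))
    (P+ (value-closed P P0 P+ y n f (λ i i<n → h i (ℕ.m≤n⇒m≤1+n i<n))) (h n ℕ.≤-refl))


-- Divisibility of coefficients by a fixed integer

∣0 : ∀ z → z ℤ.∣ 0ℤ
∣0 z = ℤ.divides 0ℤ (sym (ℤ.*-zeroˡ z))

module _ (z : ℤ) where

  ∣-respects-≡ᵐ : ∀ {x y} → z ℤ.∣ x ℤ.- y → z ℤ.∣ x → z ℤ.∣ y
  ∣-respects-≡ᵐ {x} {y} x≡y z∣x =
    subst (z ℤ.∣_) (eq x y) (ℤ.∣m∣n⇒∣m-n z∣x x≡y)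
    where
    eq : ∀ x y → x ℤ.- (x ℤ.- y) ≡ y
    eq = solve-∀

  -- Induction from the top: once all higher coefficients of `K` are divisible by `z`, the
  -- coefficient of the product at `j` is `K 0` modulo `z`, because `G j = 1`. Coefficients of the
  -- product below `j` are left free, so that the product may be the constant 1.
  monic-cancel : ∀ M {j K G} → Monic j G → (∀ i → M ≤ i → z ℤ.∣ K i) →
                 (∀ n → j ≤ n → z ℤ.∣ (K ⊛ G) n) → ∀ i → z ℤ.∣ K i
  monic-cancel zero    Gm z∣K z∣KG i = z∣K i z≤n
  monic-cancel (suc M) {j} {K} {G} Gm@(Gj , G<) z∣K z∣KG = λ where
      zero    → head j Gj (z∣KG j ℕ.≤-refl)
      (suc i) → tail i
    where
    tail : ∀ i → z ℤ.∣ K (suc i)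
    tail = monic-cancel M Gm (λ i → z∣K (suc i) ∘ s≤s) λ n j≤n →
      ℤ.∣m+n∣m⇒∣n (z∣KG (suc n) (ℕ.m≤n⇒m≤1+n j≤n))
        (subst (z ℤ.∣_) (sym (zero-*ʳ (K 0) (G< (suc n) (s≤s j≤n)))) (∣0 z))
    head : ∀ j → G j ≡ 1ℤ → z ℤ.∣ (K ⊛ G) j → z ℤ.∣ K 0
    head zero    Gj z∣KGj = subst (z ℤ.∣_) (trans (cong (K 0 ℤ.*_) Gj) (ℤ.*-identityʳ (K 0))) z∣KGj
    head (suc j) Gj z∣KGj =
      subst (z ℤ.∣_) (trans (cong (K 0 ℤ.*_) Gj) (ℤ.*-identityʳ (K 0)))
        (ℤ.∣m+n∣n⇒∣m z∣KGj
          (⊛-closed (z ℤ.∣_) ℤ.∣m∣n⇒∣m+n j (K ∘ suc) G (λ x y _ → ℤ.∣m⇒∣m*n (G y) (tail x))))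

-- Evaluation of integer polynomials

coeff : ℤ[x] → Series
coeff = Polynomial.coeff ℤ.+-*-rawSemiring

coeff-deg : ∀ Q → Deg< (length Q) (coeff Q)
coeff-deg []      i       _         = refl
coeff-deg (a ∷ Q) (suc i) (s≤s n≤i) = coeff-deg Q i n≤i

eval≡T : ∀ Q x → eval Q x ≡ T x (length Q) (coeff Q) 0
eval≡T []      x = refl
eval≡T (a ∷ Q) x = cong (λ z → a ℤ.+ x ℤ.* z) (eval≡T Q x)

eval-mod : ∀ {m} Q {x y} → x ≡ y [mod m ] → eval Q x ≡ eval Q y [mod m ]
eval-mod []      x≡y = ≡-mod-refl 0ℤ
eval-mod (a ∷ Q) {x} {y} x≡y = +-cong-mod a a (x ℤ.* eval Q x) (y ℤ.* eval Q y) (≡-mod-refl a)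
  (*-cong-mod x y (eval Q x) (eval Q y) x≡y (eval-mod Q x≡y))

-- Factorizations over the p-adic integers

-- A factorization over ℤₚ into two monic non-constant factors, given by the residues
-- of the factors modulo the powers of p.
record ApproxFactorization (p : ℕ) (F : Series) : Set where
  field
    {j m}      : ℕ
    G H        : ℕ → Series
    G-monic    : ∀ k → Monic (suc j) (G k)
    H-monic    : ∀ k → Monic (suc m) (H k)
    G-coherent : ∀ k i → G (suc k) i ≡ G k i [mod p ^ k ]
    H-coherent : ∀ k i → H (suc k) i ≡ H k i [mod p ^ k ]
    product    : ∀ k i → F i ≡ (H k ⊛ G k) i [mod p ^ k ]

factorization-cong : ∀ {p F F′} → F ≗ F′ → ApproxFactorization p F → ApproxFactorization p F′
factorization-cong F≗F′ fac = record
  { ApproxFactorization fac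
  ; product = λ k i → subst (_≡ _ [mod _ ]) (F≗F′ i) (ApproxFactorization.product fac k i)
  }

-- Irreducibility is assumed of `Q`, but the factorization is found for its translate; this carries
-- it back.
shift-factorization : ∀ c n {p F} → Deg< n F → ApproxFactorization p F →
                      ApproxFactorization p (T c n F)
shift-factorization c n {p} {F} F< fac = record
  { G = λ k → T c (2 + j) (G k)
  ; H = λ k → T c (2 + m) (H k)
  ; G-monic = λ k → T-monic c (G-monic k)
  ; H-monic = λ k → T-monic c (H-monic k)
  ; G-coherent = λ k → T-mod (2 + j) (G (suc k)) (G k) (G-coherent k)
  ; H-coherent = λ k → T-mod (2 + m) (H (suc k)) (H k) (H-coherent k)
  -- A single degree bound must serve both sides of the congruence; the sum of the two bounds does.
  ; product = λ k i → subst₂ (_≡_[mod p ^ k ])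
      (T-size c (λ x N≤x → F< x (ℕ.≤-trans (ℕ.m≤m+n n _) N≤x)) F< i)
      (trans (T-extend c (ℕ.m≤n+m (2 + m + (2 + j)) n) (HG-deg k) i)
             (T-⊛ c (2 + m) (2 + j) (proj₂ (H-monic k)) (proj₂ (G-monic k)) i))
      (T-mod (n + (2 + m + (2 + j))) F (H k ⊛ G k) (product k) i)
  }
  where
  open ApproxFactorization fac
  HG-deg : ∀ k → Deg< (2 + m + (2 + j)) (H k ⊛ G k)
  HG-deg k i N≤i = ⊛-deg (proj₂ (H-monic k)) (proj₂ (G-monic k)) i (ℕ.≤-trans (ℕ.n≤1+n _) N≤i)
  T-mod : ∀ n {N} f g → (∀ i → f i ≡ g i [mod N ]) → ∀ i → T c n f i ≡ T c n g i [mod N ]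
  T-mod n {N} f g f≡g i = subst (+ N ℤ.∣_) T-sub
    (T-closed (+ N ℤ.∣_) (∣0 (+ N)) ℤ.∣m∣n⇒∣m+n (λ c → ℤ.∣n⇒∣m*n c) c n f≡g i)
    where
    T-sub : T c n (λ i → f i ℤ.- g i) i ≡ T c n f i ℤ.- T c n g i
    T-sub = trans (T-cong c n (λ k → cong (λ z → f k ℤ.+ z) (sym (ℤ.-1*i≡-i (g k)))) i)
      (trans (T-⊕ c n f (ℤ.-1ℤ · g) i)
      (cong (λ z → T c n f i ℤ.+ z) (trans (T-· c n ℤ.-1ℤ g i) (ℤ.-1*i≡-i (T c n g i)))))

module _ (p : ℕ) where

  private
    module ℤₚ[x] = Polynomial (ℤₚ-rawSemiring p)

  open ℤₚ[x] using (_+ₚ_; _*ₚ_)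

  residue : ℤₚ[x].Poly → ℕ → Series
  residue f k i = approx (ℤₚ[x].coeff f i) k

  residue-+ : ∀ f g k → residue (f +ₚ g) k ≗ residue f k ⊕ residue g k
  residue-+ []      g       k i       = sym (ℤ.+-identityˡ _)
  residue-+ (a ∷ f) []      k i       = sym (ℤ.+-identityʳ _)
  residue-+ (a ∷ f) (b ∷ g) k zero    = refl
  residue-+ (a ∷ f) (b ∷ g) k (suc i) = residue-+ f g k i

  residue-scale : ∀ a g k →
    residue (map (RawSemiring._*_ (ℤₚ-rawSemiring p) a) g) k ≗ approx a k · residue g k
  residue-scale a []      k i       = sym (ℤ.*-zeroʳ (approx a k))
  residue-scale a (b ∷ g) k zero    = refl
  residue-scale a (b ∷ g) k (suc i) = residue-scale a g k i

  residue-* : ∀ f g k → residue (f *ₚ g) k ≗ residue f k ⊛ residue g k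
  residue-* []      g k i       = sym (⊛-zeroˡ (λ _ → refl) (residue g k) i)
  residue-* (a ∷ f) g k zero    =
    trans (residue-+ (map _ g) _ k 0) (trans (x+0 refl) (residue-scale a g k 0))
  residue-* (a ∷ f) g k (suc i) =
    trans (residue-+ (map _ g) _ k (suc i))
          (cong₂ ℤ._+_ (residue-scale a g k (suc i)) (residue-* f g k i))

  residue-deg : ∀ f k → Deg< (length f) (residue f k)
  residue-deg []      k i       _         = refl
  residue-deg (a ∷ f) k (suc i) (s≤s n≤i) = residue-deg f k i n≤i

  residue-fromℤ : ∀ Q k → residue (map (fromℤ p) Q) k ≗ coeff Q
  residue-fromℤ []      k i       = refl
  residue-fromℤ (a ∷ Q) k zero    = refl
  residue-fromℤ (a ∷ Q) k (suc i) = residue-fromℤ Q k i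

  residue-applyUpTo : ∀ (h : ℕ → ℤ[ p ]-adic) k n → Deg< n (λ i → approx (h i) k) →
                      residue (applyUpTo h n) k ≗ λ i → approx (h i) k
  residue-applyUpTo h k zero    h< i       = sym (h< i z≤n)
  residue-applyUpTo h k (suc n) h< zero    = refl
  residue-applyUpTo h k (suc n) h< (suc i) =
    residue-applyUpTo (h ∘ suc) k n (λ x → h< (suc x) ∘ s≤s) i

  -- Modulo `p`, the product of `f` and an inverse `q` has no coefficients in positive degree. As
  -- `f` is monic of positive degree, `q` vanishes modulo `p`, and then so does 1.
  monic-nonunit : Prime p → ∀ {j} f → Monic (suc j) (residue f 1) →
                  ¬ RS._∣_ ℤₚ[x].polyRawSemiring f (RawSemiring.1# ℤₚ[x].polyRawSemiring)
  monic-nonunit pr {j} f f-monic (q RM., qf≈1) =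
    contradiction (ℕ.∣1⇒≡1 (subst (ℕ._∣ 1) (ℕ.*-identityʳ p) (ℤ.∣⇒∣ᵤ pᵏ∣1)))
                  (ℕ.nonTrivial⇒≢1 {{prime⇒nonTrivial pr}})
    where
    pᵏ = + (p ^ 1)
    one : Series
    one = residue (RawSemiring.1# ℤₚ[x].polyRawSemiring) 1
    qf≡1 : ∀ i → pᵏ ℤ.∣ (residue q 1 ⊛ residue f 1) i ℤ.- one i
    qf≡1 i = subst (λ x → pᵏ ℤ.∣ x ℤ.- one i) (residue-* q f 1 i) (qf≈1 i 1)
    pᵏ∣q : ∀ i → pᵏ ℤ.∣ residue q 1 i
    pᵏ∣q = monic-cancel pᵏ (length q) f-monic
      (λ i n≤i → subst (pᵏ ℤ.∣_) (sym (residue-deg q 1 i n≤i)) (∣0 pᵏ))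
      (λ where (suc n) _ → subst (pᵏ ℤ.∣_) (ℤ.+-identityʳ _) (qf≡1 (suc n)))
    pᵏ∣1 : pᵏ ℤ.∣ 1ℤ
    pᵏ∣1 = ∣-respects-≡ᵐ pᵏ (qf≡1 0) (ℤ.∣m⇒∣m*n (residue f 1 0) (pᵏ∣q 0))

  irreducible⇒¬factorization : Prime p → ∀ Q → IrreducibleOverℤₚ p Q →
    ¬ ApproxFactorization p (coeff Q)
  irreducible⇒¬factorization pr Q irr fac = helper (RS.Irreducible.split-∣1 irr {h} {g} Q≈hg)
    where
    open ApproxFactorization fac
    gᵢ hᵢ : ℕ → ℤ[ p ]-adic
    gᵢ i = mkℤₚ (λ k → G k i) (λ k → G-coherent k i)
    hᵢ i = mkℤₚ (λ k → H k i) (λ k → H-coherent k i)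
    g h : ℤₚ[x].Poly
    g = applyUpTo gᵢ (2 + j)
    h = applyUpTo hᵢ (2 + m)
    residue-g : ∀ k → residue g k ≗ G k
    residue-g k = residue-applyUpTo gᵢ k (2 + j) (proj₂ (G-monic k))
    residue-h : ∀ k → residue h k ≗ H k
    residue-h k = residue-applyUpTo hᵢ k (2 + m) (proj₂ (H-monic k))
    Q≈hg : ∀ i k → residue (map (fromℤ p) Q) k i ≡ residue (h *ₚ g) k i [mod p ^ k ]
    Q≈hg i k = subst₂ (_≡_[mod p ^ k ]) (sym (residue-fromℤ Q k i))
      (sym (trans (residue-* h g k i) (⊛-cong (residue-h k) (residue-g k) i))) (product k i)
    monic-cong : ∀ {n f f′} → f ≗ f′ → Monic n f′ → Monic n f
    monic-cong f≗f′ (lead , deg) = trans (f≗f′ _) lead , λ i n≤i → trans (f≗f′ i) (deg i n≤i)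
    helper : _ → _
    helper (inj₁ h∣1) = monic-nonunit pr h (monic-cong (residue-h 1) (H-monic 1)) h∣1
    helper (inj₂ g∣1) = monic-nonunit pr g (monic-cong (residue-g 1) (G-monic 1)) g∣1

-- Weights

∣-^ : ∀ p {e e′} → e ≤ e′ → + (p ^ e) ℤ.∣ + (p ^ e′)
∣-^ p {e} e≤e′ with o , refl ← ℕ.m≤n⇒∃[o]m+o≡n e≤e′ =
  ℤ.∣ᵤ⇒∣ (subst (p ^ e ℕ.∣_) (sym (ℕ.^-distribˡ-+-* p e o)) (ℕ.m∣m*n (p ^ o)))

^-*-∣ : ∀ p e e′ {x y} → + (p ^ e) ℤ.∣ x → + (p ^ e′) ℤ.∣ y → + (p ^ (e + e′)) ℤ.∣ x ℤ.* y
^-*-∣ p e e′ (ℤ.divides q refl) (ℤ.divides q′ refl) = ℤ.divides (q ℤ.* q′)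
  (trans (eq q q′ (+ (p ^ e)) (+ (p ^ e′)))
         (cong (λ z → q ℤ.* q′ ℤ.* z)
           (trans (sym (ℤ.pos-* (p ^ e) (p ^ e′))) (cong +_ (sym (ℕ.^-distribˡ-+-* p e e′))))))
  where
  eq : ∀ q q′ P P′ → (q ℤ.* P) ℤ.* (q′ ℤ.* P′) ≡ q ℤ.* q′ ℤ.* (P ℤ.* P′)
  eq = solve-∀

-- In Val t W x, read x as the coefficient of a monomial xⁱ with t = a i: the inequality
-- says that t + b ν(x) is at least W, that is, that the point (i , ν(x)) of the Newton
-- polygon lies on or above the line a i + b v = W of slope - a / b.
module Weight (p b : ℕ) .{{b≢0 : ℕ.NonZero b}} where

  Val : ℕ → ℕ → ℤ → Set
  Val t W x = ∃[ e ] (W ≤ t + b * e × + (p ^ e) ℤ.∣ x)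

  Val-0 : ∀ {t W x} → x ≡ 0ℤ → Val t W x
  Val-0 {t} {W} refl = W , ℕ.≤-trans (ℕ.m≤n*m W b) (ℕ.m≤n+m (b * W) t) , ∣0 (+ (p ^ W))

  Val-mono : ∀ {t t′ W W′ x} → t ≤ t′ → W′ ≤ W → Val t W x → Val t′ W′ x
  Val-mono t≤t′ W′≤W (e , W≤ , pᵉ∣x) =
    e , ℕ.≤-trans W′≤W (ℕ.≤-trans W≤ (ℕ.+-monoˡ-≤ (b * e) t≤t′)) , pᵉ∣x

  Val-≡ : ∀ {t t′ W W′ x} → t ≡ t′ → W ≡ W′ → Val t W x → Val t′ W′ x
  Val-≡ refl refl v = v

  Val-cancel : ∀ u {t W x} → Val (u + t) (u + W) x → Val t W x
  Val-cancel u {t} {W} (e , u+W≤ , pᵉ∣x) =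
    e , ℕ.+-cancelˡ-≤ u _ _ (subst (u + W ≤_) (ℕ.+-assoc u t (b * e)) u+W≤) , pᵉ∣x

  Val-+ : ∀ {t W x y} → Val t W x → Val t W y → Val t W (x ℤ.+ y)
  Val-+ (e , W≤ , pᵉ∣x) (e′ , W≤′ , pᵉ′∣y) with ℕ.≤-total e e′
  ... | inj₁ e≤e′ = e  , W≤  , ℤ.∣m∣n⇒∣m+n pᵉ∣x (ℤ.∣-trans (∣-^ p e≤e′) pᵉ′∣y)
  ... | inj₂ e′≤e = e′ , W≤′ , ℤ.∣m∣n⇒∣m+n (ℤ.∣-trans (∣-^ p e′≤e) pᵉ∣x) pᵉ′∣y

  Val-*ˡ : ∀ c {t W x} → Val t W x → Val t W (c ℤ.* x)
  Val-*ˡ c (e , W≤ , pᵉ∣x) = e , W≤ , ℤ.∣n⇒∣m*n c pᵉ∣x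

  Val-neg : ∀ {t W x} → Val t W x → Val t W (ℤ.- x)
  Val-neg (e , W≤ , pᵉ∣x) = e , W≤ , ℤ.∣m⇒∣-m pᵉ∣x

  Val-* : ∀ {t t′ W W′ x y} → Val t W x → Val t′ W′ y → Val (t + t′) (W + W′) (x ℤ.* y)
  Val-* {t} {t′} {W} {W′} (e , W≤ , pᵉ∣x) (e′ , W′≤ , pᵉ′∣y) =
    e + e′ , subst (W + W′ ≤_) (eq t t′ b e e′) (ℕ.+-mono-≤ W≤ W′≤) , ^-*-∣ p e e′ pᵉ∣x pᵉ′∣y
    where
    eq : ∀ t t′ b e e′ → (t + b * e) + (t′ + b * e′) ≡ t + t′ + b * (e + e′)
    eq = ℕ-Solver.solve-∀

  -- From `t ≤ W` and `b s + W ≤ t + b e` follows `s ≤ e`, so `pˢ` can be taken out, at a cost of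
  -- exactly `b s` in weight.
  Val-÷ : ∀ s {t W x} → t ≤ W → Val t (b * s + W) x →
          ∃[ q ] (x ≡ q ℤ.* + (p ^ s) × Val t W q)
  Val-÷ s {t} {W} {x} t≤W (e , W≤ , ℤ.divides q x≡qpᵉ)
    with o , refl ← ℕ.m≤n⇒∃[o]m+o≡n {s} {e} (ℕ.*-cancelˡ-≤ b (ℕ.+-cancelˡ-≤ t (b * s) (b * e)
           (ℕ.≤-trans (ℕ.≤-trans (ℕ.≤-reflexive (ℕ.+-comm t (b * s))) (ℕ.+-monoʳ-≤ (b * s) t≤W)) W≤)))
    = q ℤ.* + (p ^ o) , x≡ , o , W≤o , ℤ.∣n⇒∣m*n q ℤ.∣-refl
    where
    eq : ∀ t b s o → t + b * (s + o) ≡ b * s + (t + b * o)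
    eq = ℕ-Solver.solve-∀
    W≤o : W ≤ t + b * o
    W≤o = ℕ.+-cancelˡ-≤ (b * s) _ _ (subst (b * s + W ≤_) (eq t b s o) W≤)
    eq′ : ∀ q x y → q ℤ.* (x ℤ.* y) ≡ q ℤ.* y ℤ.* x
    eq′ = solve-∀
    x≡ : x ≡ q ℤ.* + (p ^ o) ℤ.* + (p ^ s)
    x≡ = trans x≡qpᵉ (trans (cong (λ z → q ℤ.* z)
           (trans (cong +_ (ℕ.^-distribˡ-+-* p s o)) (ℤ.pos-* (p ^ s) (p ^ o))))
           (eq′ q (+ (p ^ s)) (+ (p ^ o))))

  -- The least weight of a coefficient is a Gauss valuation on polynomials; this is the inequality
  -- for products.
  Val-⊛ : ∀ {a W W′ f g} → (∀ i → Val (a * i) W (f i)) → (∀ i → Val (a * i) W′ (g i)) →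
          ∀ i → Val (a * i) (W + W′) ((f ⊛ g) i)
  Val-⊛ {a} {f = f} {g} Vf Vg i = ⊛-closed (Val (a * i) _) Val-+ i f g
    λ x y x+y≡i → Val-≡ (trans (sym (ℕ.*-distribˡ-+ a x y)) (cong (a *_) x+y≡i)) refl
                        (Val-* (Vf x) (Vg y))

  -- `K` multiplies the leading term `x^j` of `G`, whence the extra `a * j` in its weight. The
  -- offset `t` keeps track of positions when the induction drops the constant coefficient of `S`.
  record Division (a j m t W : ℕ) (G S : Series) : Set where
    field
      K R   : Series
      K-deg : Deg< m K
      R-deg : Deg< j R
      S≗    : S ≗ K ⊛ G ⊕ R
      K-val : ∀ i → Val (t + a * j + a * i) W (K i)
      R-val : ∀ i → Val (t + a * i) W (R i)

  -- Divide `S = S 0 + x S₁` by dividing `S₁` first; the remainder `S 0 + x R₁` may have a top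
  -- coefficient `c` in the degree of `G`, which subtracting `c G` removes. No weight is lost, since
  -- no term of `G` weighs less than its leading term.
  division : ∀ {a j G} → Monic (suc j) G → (∀ i → Val (a * i) (a * suc j) (G i)) →
             ∀ m {t W S} → Deg< (suc j + m) S → (∀ i → Val (t + a * i) W (S i)) →
             Division a (suc j) m t W G S
  division {a} {j} {G} Gm G-val zero {t} {W} {S} S-deg S-val = record
    { K = λ _ → 0ℤ
    ; R = S
    ; K-deg = λ _ _ → refl
    ; R-deg = subst (λ n → Deg< n S) (ℕ.+-identityʳ (suc j)) S-deg
    ; S≗    = λ i → sym (trans (cong (ℤ._+ S i) (⊛-zeroˡ (λ _ → refl) G i)) (ℤ.+-identityˡ _))
    ; K-val = λ i → Val-0 refl
    ; R-val = S-val
    }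
  division {a} {j} {G} Gm@(Gj , G-deg) G-val (suc m) {t} {W} {S} S-deg S-val = record
    { K = c ∷ˢ K₁
    ; R = R′
    ; K-deg = λ where (suc i) (s≤s m≤i) → K₁-deg i m≤i
    ; R-deg = R′-deg
    ; S≗    = S≗
    ; K-val = K-val
    ; R-val = λ i → Val-+ (head-val i) (cG-val i)
    }
    where
    S-val′ : ∀ i → Val (t + a + a * i) W (S (suc i))
    S-val′ i = Val-≡ (eq t a i) refl (S-val (suc i))
      where
      eq : ∀ t a i → t + a * suc i ≡ t + a + a * i
      eq = ℕ-Solver.solve-∀
    open Division (division {a} Gm G-val m {t + a}
        (λ i n≤i → S-deg (suc i) (s≤s (subst (_≤ i) (sym (ℕ.+-suc j m)) n≤i))) S-val′)
      renaming (K to K₁; R to R₁; K-deg to K₁-deg; R-deg to R₁-deg;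
                S≗ to S₁≗; K-val to K₁-val; R-val to R₁-val)
    c = R₁ j
    R′ = (S 0 ∷ˢ R₁) ⊕ (ℤ.- c) · G
    R′-deg : Deg< (suc j) R′
    R′-deg (suc i) (s≤s j≤i) with ℕ.m≤n⇒m<n∨m≡n j≤i
    ... | inj₁ j<i  = zero-+ (R₁-deg i j<i) (zero-*ʳ (ℤ.- c) (G-deg (suc i) (s≤s j<i)))
    ... | inj₂ refl = trans (cong (λ z → c ℤ.+ ℤ.- c ℤ.* z) Gj) (eq c)
      where
      eq : ∀ c → c ℤ.+ ℤ.- c ℤ.* 1ℤ ≡ 0ℤ
      eq = solve-∀
    S≗ : S ≗ (c ∷ˢ K₁) ⊛ G ⊕ R′
    S≗ zero    = eq (S 0) c (G 0)
      where
      eq : ∀ s c g → s ≡ c ℤ.* g ℤ.+ (s ℤ.+ ℤ.- c ℤ.* g)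
      eq = solve-∀
    S≗ (suc i) = trans (S₁≗ i) (eq ((K₁ ⊛ G) i) (R₁ i) c (G (suc i)))
      where
      eq : ∀ k r c g → k ℤ.+ r ≡ c ℤ.* g ℤ.+ k ℤ.+ (r ℤ.+ ℤ.- c ℤ.* g)
      eq = solve-∀
    c-val : Val (t + a * suc j) W c
    c-val = Val-≡ (eq t a j) refl (R₁-val j)
      where
      eq : ∀ t a j → t + a + a * j ≡ t + a * suc j
      eq = ℕ-Solver.solve-∀
    K-val : ∀ i → Val (t + a * suc j + a * i) W ((c ∷ˢ K₁) i)
    K-val zero    = Val-mono (ℕ.m≤m+n _ _) ℕ.≤-refl c-val
    K-val (suc i) = Val-≡ (eq t a j i) refl (K₁-val i)
      where
      eq : ∀ t a j i → t + a + a * suc j + a * i ≡ t + a * suc j + a * suc i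
      eq = ℕ-Solver.solve-∀
    head-val : ∀ i → Val (t + a * i) W ((S 0 ∷ˢ R₁) i)
    head-val zero    = S-val 0
    head-val (suc i) = Val-≡ (eq t a i) refl (R₁-val i)
      where
      eq : ∀ t a i → t + a + a * i ≡ t + a * suc i
      eq = ℕ-Solver.solve-∀
    cG-val : ∀ i → Val (t + a * i) W (ℤ.- c ℤ.* G i)
    cG-val i = Val-cancel (a * suc j)
      (Val-≡ (eq t a i j) (ℕ.+-comm W (a * suc j)) (Val-* (Val-neg c-val) (G-val i)))
      where
      eq : ∀ t a i j → t + a * suc j + a * i ≡ a * suc j + (t + a * i)
      eq = ℕ-Solver.solve-∀

-- Hensel lifting along the Newton polygon

xpow : ℕ → Series
xpow zero    = 1ℤ ∷ˢ λ _ → 0ℤ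
xpow (suc j) = 0ℤ ∷ˢ xpow j

low : ℕ → Series → Series
low zero    f = λ _ → 0ℤ
low (suc j) f = f 0 ∷ˢ low j (f ∘ suc)

xpow-monic : ∀ j → Monic j (xpow j)
xpow-monic zero    = refl , λ where (suc i) _ → refl
xpow-monic (suc j) = proj₁ (xpow-monic j) , λ where
  (suc i) (s≤s j<i) → proj₂ (xpow-monic j) i j<i

xpow-support : ∀ j i → i ≡ j ⊎ xpow j i ≡ 0ℤ
xpow-support zero    zero    = inj₁ refl
xpow-support zero    (suc i) = inj₂ refl
xpow-support (suc j) zero    = inj₂ refl
xpow-support (suc j) (suc i) with xpow-support j i
... | inj₁ refl = inj₁ refl
... | inj₂ eq   = inj₂ eq

low-deg : ∀ j f → Deg< j (low j f)
low-deg zero    f i       _         = refl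
low-deg (suc j) f (suc i) (s≤s j≤i) = low-deg j (f ∘ suc) i j≤i

low-coeff : ∀ j f i → low j f i ≡ f i ⊎ low j f i ≡ 0ℤ
low-coeff zero    f i       = inj₂ refl
low-coeff (suc j) f zero    = inj₁ refl
low-coeff (suc j) f (suc i) = low-coeff j (f ∘ suc) i

⊛-xpow0 : ∀ f → f ⊛ xpow 0 ≗ f
⊛-xpow0 f zero    = ℤ.*-identityʳ (f 0)
⊛-xpow0 f (suc n) = trans (cong₂ ℤ._+_ (ℤ.*-zeroʳ (f 0)) (⊛-xpow0 (f ∘ suc) n)) (ℤ.+-identityˡ _)

⊛-shift : ∀ f g → f ⊛ (0ℤ ∷ˢ g) ≗ 0ℤ ∷ˢ f ⊛ g
⊛-shift f g zero          = ℤ.*-zeroʳ (f 0)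
⊛-shift f g (suc zero)    = x+0 (ℤ.*-zeroʳ (f 1))
⊛-shift f g (suc (suc n)) = cong (λ z → f 0 ℤ.* g (suc n) ℤ.+ z) (⊛-shift (f ∘ suc) g (suc n))

split-at : ∀ j f → f ≗ (λ i → f (j + i)) ⊛ xpow j ⊕ low j f
split-at zero    f i       = sym (trans (x+0 refl) (⊛-xpow0 f i))
split-at (suc j) f zero    =
  sym (trans (cong (ℤ._+ f 0) (⊛-shift (λ i → f (suc j + i)) (xpow j) 0)) (ℤ.+-identityˡ (f 0)))
split-at (suc j) f (suc i) =
  trans (split-at j (f ∘ suc) i)
        (cong (ℤ._+ low j (f ∘ suc) i) (sym (⊛-shift (λ i → f (suc j + i)) (xpow j) (suc i))))

-- Let (J , s) be the last point of the Newton polygon of F on its supporting line of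
-- slope - a / b, with 0 < J < d.  Then the J roots of F of valuation at least a / b are
-- the roots of a factor of degree J.
module Hensel (p : ℕ) (a b : ℕ) .{{b≢0 : ℕ.NonZero b}} (j m s : ℕ) (F : Series)
  (F-monic : Monic (suc j + suc m) F) (u u′ : ℤ) (uu′≡1 : + (p ^ 1) ℤ.∣ 1ℤ ℤ.- u ℤ.* u′)
  (F-J : F (suc j) ≡ u ℤ.* + (p ^ s))
  (F-val : ∀ i → Weight.Val p b (a * i) (b * s + a * suc j) (F i))
  (F-val⁺ : ∀ i → suc j < i → Weight.Val p b (a * i) (suc (b * s + a * suc j)) (F i))
  where

  open Weight p b

  J M : ℕ
  J = suc j
  M = suc m

  -- The part of `H` of least weight: by `F-val⁺` the other coefficients of the initial `H` weigh
  -- more than `b s`.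
  corner : Series
  corner = (u ℤ.* + (p ^ s)) ∷ˢ λ _ → 0ℤ

  -- The error `R` exceeds the weight `b s + a J` of `F` by `n`. The bound on `G` is not strict, as
  -- its terms below `x^J` may lie on the supporting line too; the bound on `H - corner` has to be
  -- strict, for that is where a round gains its unit.
  record Stage (n : ℕ) : Set where
    field
      G H R   : Series
      G-monic : Monic J G
      H-monic : Monic M H
      R-deg   : Deg< J R
      F≗      : F ≗ H ⊛ G ⊕ R
      G-val   : ∀ i → Val (a * i) (a * J) (G i)
      H-val   : ∀ i → Val (a * i) (suc (b * s)) (H i ℤ.- corner i)
      R-val   : ∀ i → Val (a * i) (b * s + (a * J + n)) (R i)

  open Stage

  initial : Stage 0
  initial = record
    { G = xpow J
    ; H = λ i → F (J + i)
    ; R = low J F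
    ; G-monic = xpow-monic J
    ; H-monic = proj₁ F-monic , λ i M<i → proj₂ F-monic (J + i)
        (subst (_≤ J + i) (ℕ.+-suc J M) (ℕ.+-monoʳ-≤ J M<i))
    ; R-deg = low-deg J F
    ; F≗ = split-at J F
    ; G-val = G-val₀
    ; H-val = H-val₀
    ; R-val = R-val₀
    }
    where
    G-val₀ : ∀ i → Val (a * i) (a * J) (xpow J i)
    G-val₀ i with xpow-support J i
    ... | inj₁ refl = 0 , ℕ.m≤m+n _ _ , ℤ.∣ᵤ⇒∣ (ℕ.1∣ _)
    ... | inj₂ eq   = Val-0 eq
    H-val₀ : ∀ i → Val (a * i) (suc (b * s)) (F (J + i) ℤ.- corner i)
    H-val₀ zero    = Val-0
      (trans (cong (ℤ._- corner 0) (trans (cong F (ℕ.+-identityʳ J)) F-J)) (ℤ.+-inverseʳ (corner 0)))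
    H-val₀ (suc i) = subst (Val _ _) (sym (ℤ.+-identityʳ _))
      (Val-cancel (a * J)
        (Val-≡ (ℕ.*-distribˡ-+ a J (suc i))
          (trans (cong suc (ℕ.+-comm (b * s) (a * J))) (sym (ℕ.+-suc (a * J) (b * s))))
          (F-val⁺ (J + suc i) (ℕ.m<m+n J (s≤s z≤n)))))
    R-val₀ : ∀ i → Val (a * i) (b * s + (a * J + 0)) (low J F i)
    R-val₀ i with low-coeff J F i
    ... | inj₁ eq = subst (Val _ _) (sym eq)
      (Val-≡ refl (cong (λ z → b * s + z) (sym (ℕ.+-identityʳ (a * J)))) (F-val i))
    ... | inj₂ eq = Val-0 eq

  record Next {n} (A : Stage n) : Set where
    field
      next    : Stage (suc n)
      G-close : ∀ i → Val (a * i) n (G next i ℤ.- G A i)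
      H-close : ∀ i → Val (a * i) n (H next i ℤ.- H A i)

  -- With D = u′ R / pˢ the factor G + D leaves the error R - H D, in which the leading
  -- part u pˢ D of H D cancels R modulo p.
  step : ∀ {n} (A : Stage n) → Next A
  step {n} A = record
    { next = record
      { G = G′
      ; H = H A ⊕ K
      ; R = R′
      ; G-monic = G′-monic
      ; H-monic = trans (x+0 (K-deg M ℕ.≤-refl)) (proj₁ (H-monic A)) ,
                  λ i M<i → zero-+ (proj₂ (H-monic A) i M<i) (K-deg i (ℕ.<⇒≤ M<i))
      ; R-deg = R′-deg
      ; F≗ = F≗′
      ; G-val = G′-val
      ; H-val = λ i → subst (Val _ _) (eq₁ (H A i) (corner i) (K i))
          (Val-+ (H-val A i) (Val-mono ℕ.≤-refl (s≤s (ℕ.m≤m+n (b * s) n)) (K-val′ i)))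
      ; R-val = R′-val
      }
    ; G-close = λ i → subst (Val _ _) (eq₂ (G A i) (D i))
        (Val-mono ℕ.≤-refl (ℕ.m≤n+m n (a * J)) (D-val i))
    ; H-close = λ i → subst (Val _ _) (eq₂ (H A i) (K i))
        (Val-mono ℕ.≤-refl (ℕ.≤-trans (ℕ.m≤n+m n (b * s)) (ℕ.n≤1+n _)) (K-val′ i))
    }
    where
    eq₁ : ∀ h c k → h ℤ.- c ℤ.+ k ≡ h ℤ.+ k ℤ.- c
    eq₁ = solve-∀
    eq₂ : ∀ g d → d ≡ g ℤ.+ d ℤ.- g
    eq₂ = solve-∀

    quotient : ∀ i → ∃[ q ] (R A i ≡ q ℤ.* + (p ^ s) × Val (a * i) (a * J + n) q × (J ≤ i → q ≡ 0ℤ))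
    quotient i with ℕ.<-≤-connex i J
    -- From `J` on, `a i` may exceed `a J + n`, so `Val-÷` does not apply; `R` vanishes there, and
    -- the quotient 0 keeps the degree of `D` below `J`.
    ... | inj₂ J≤i = 0ℤ , R-deg A i J≤i , Val-0 refl , λ _ → refl
    ... | inj₁ i<J =
      let q , eq , v = Val-÷ s (ℕ.≤-trans (ℕ.*-monoʳ-≤ a (ℕ.<⇒≤ i<J)) (ℕ.m≤m+n (a * J) n)) (R-val A i)
      in q , eq , v , λ J≤i → contradiction J≤i (ℕ.<⇒≱ i<J)

    q : Series
    q = proj₁ ∘ quotient
    D G′ S : Series
    D = u′ · q
    G′ = G A ⊕ D
    S i = R A i ℤ.- (H A ⊛ D) i

    D-val : ∀ i → Val (a * i) (a * J + n) (D i)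
    D-val i = Val-*ˡ u′ (proj₁ (proj₂ (proj₂ (quotient i))))
    D-deg : Deg< J D
    D-deg i J≤i = zero-*ʳ u′ (proj₂ (proj₂ (proj₂ (quotient i))) J≤i)
    G′-monic : Monic J G′
    G′-monic = trans (x+0 (D-deg J ℕ.≤-refl)) (proj₁ (G-monic A)) ,
               λ i J<i → zero-+ (proj₂ (G-monic A) i J<i) (D-deg i (ℕ.<⇒≤ J<i))
    G′-val : ∀ i → Val (a * i) (a * J) (G′ i)
    G′-val i = Val-+ (G-val A i) (Val-mono ℕ.≤-refl (ℕ.m≤m+n (a * J) n) (D-val i))

    S-deg : Deg< (J + M) S
    S-deg i d≤i = zero-+ (R-deg A i (ℕ.≤-trans (ℕ.m≤m+n J M) d≤i))
      (cong ℤ.-_ (⊛-deg (proj₂ (H-monic A)) D-deg i (subst (_≤ i) (ℕ.+-comm J M) d≤i)))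

    E : Series
    E i = H A i ℤ.- corner i

    S≡ : ∀ i → R A i ℤ.* (1ℤ ℤ.- u ℤ.* u′) ℤ.- (E ⊛ D) i ≡ S i
    S≡ i = trans (cong (λ r → r ℤ.* (1ℤ ℤ.- u ℤ.* u′) ℤ.- (E ⊛ D) i) R≡)
      (trans (eq (q i) (+ (p ^ s)) u u′ ((E ⊛ D) i))
             (sym (cong₂ ℤ._-_ R≡ HD)))
      where
      R≡ : R A i ≡ q i ℤ.* + (p ^ s)
      R≡ = proj₁ (proj₂ (quotient i))
      eq′ : ∀ h c → h ≡ h ℤ.- c ℤ.+ c
      eq′ = solve-∀
      HD : (H A ⊛ D) i ≡ (E ⊛ D) i ℤ.+ u ℤ.* + (p ^ s) ℤ.* (u′ ℤ.* q i)
      HD = trans (⊛-cong (λ k → eq′ (H A k) (corner k)) (λ _ → refl) i)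
           (trans (⊛-distribʳ E corner D i)
                  (cong (λ z → (E ⊛ D) i ℤ.+ z) (⊛-constˡ (u ℤ.* + (p ^ s)) D i)))
      eq : ∀ q P u u′ x → q ℤ.* P ℤ.* (1ℤ ℤ.- u ℤ.* u′) ℤ.- x ≡
                          q ℤ.* P ℤ.- (x ℤ.+ u ℤ.* P ℤ.* (u′ ℤ.* q))
      eq = solve-∀

    -- In the form given by `S≡`, the factor `1 - u u′` is divisible by `p` and adds `b`, at least
    -- 1, to the weight of `R`, while `E` weighs at least `b s + 1`.
    S-val : ∀ i → Val (a * i) (b * s + (a * J + suc n)) (S i)
    S-val i = subst (Val _ _) (S≡ i) (Val-+
      (Val-mono (ℕ.≤-reflexive (ℕ.+-identityʳ (a * i))) bound
        (Val-* (R-val A i) (1 , ℕ.≤-reflexive (sym (ℕ.*-identityʳ b)) , uu′≡1)))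
      (Val-neg (Val-≡ refl (eq (b * s) (a * J) n) (Val-⊛ {a} {f = E} {D} (H-val A) D-val i))))
      where
      eq : ∀ x y n → suc x + (y + n) ≡ x + (y + suc n)
      eq = ℕ-Solver.solve-∀
      eq′ : ∀ x y n → x + (y + n) + 1 ≡ x + (y + suc n)
      eq′ = ℕ-Solver.solve-∀
      bound : b * s + (a * J + suc n) ≤ b * s + (a * J + n) + b
      bound = subst (_≤ b * s + (a * J + n) + b) (eq′ (b * s) (a * J) n)
                (ℕ.+-monoʳ-≤ (b * s + (a * J + n)) (ℕ.>-nonZero⁻¹ b))

    -- `S` may have any degree below `J + M`. Division by the new `G` brings the error below `J`
    -- again, and the quotient, of degree below `M`, is absorbed by `H`.
    open Division (division {a} G′-monic G′-val M {0} {S = S} S-deg S-val)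
      renaming (R to R′; R-deg to R′-deg; R-val to R′-val)

    K-val′ : ∀ i → Val (a * i) (suc (b * s + n)) (K i)
    K-val′ i = Val-cancel (a * J) (Val-≡ refl (eq (b * s) (a * J) n) (K-val i))
      where
      eq : ∀ x y n → x + (y + suc n) ≡ y + suc (x + n)
      eq = ℕ-Solver.solve-∀

    F≗′ : F ≗ (H A ⊕ K) ⊛ G′ ⊕ R′
    F≗′ i = begin
      F i
        ≡⟨ F≗ A i ⟩
      (H A ⊛ G A) i ℤ.+ R A i
        ≡⟨ eq ((H A ⊛ G A) i) (R A i) ((H A ⊛ D) i) ⟩
      ((H A ⊛ G A) i ℤ.+ (H A ⊛ D) i) ℤ.+ S i
        ≡⟨ cong₂ ℤ._+_ (sym (⊛-distribˡ (H A) (G A) D i)) (S≗ i) ⟩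
      (H A ⊛ G′) i ℤ.+ ((K ⊛ G′) i ℤ.+ R′ i)
        ≡⟨ sym (ℤ.+-assoc ((H A ⊛ G′) i) ((K ⊛ G′) i) (R′ i)) ⟩
      (H A ⊛ G′) i ℤ.+ (K ⊛ G′) i ℤ.+ R′ i
        ≡⟨ cong (ℤ._+ R′ i) (sym (⊛-distribʳ (H A) K G′ i)) ⟩
      ((H A ⊕ K) ⊛ G′) i ℤ.+ R′ i ∎
      where
      open ≡-Reasoning
      eq : ∀ x r y → x ℤ.+ r ≡ (x ℤ.+ y) ℤ.+ (r ℤ.- y)
      eq = solve-∀

  stage : ∀ n → Stage n
  stage zero    = initial
  stage (suc n) = Next.next (step (stage n))

  -- At every position up to `J + M`, weight `a (J + M) + b k` forces divisibility by `p ^ k`, so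
  -- each further power of `p` takes `b` rounds. The recursive form lets `index (suc k)` unfold to
  -- `b + index k`, as `converges` uses.
  index : ℕ → ℕ
  index zero    = a * (J + M)
  index (suc k) = b + index k

  index≡ : ∀ k → index k ≡ a * (J + M) + b * k
  index≡ zero    = sym (trans (cong (λ z → a * (J + M) + z) (ℕ.*-zeroʳ b)) (ℕ.+-identityʳ _))
  index≡ (suc k) = trans (cong (λ z → b + z) (index≡ k)) (eq (a * (J + M)) b k)
    where
    eq : ∀ x b k → b + (x + b * k) ≡ x + b * suc k
    eq = ℕ-Solver.solve-∀

  Val⇒∣ : ∀ {k i n x} → i ≤ J + M → index k ≤ n → Val (a * i) n x → + (p ^ k) ℤ.∣ x
  Val⇒∣ {k} {i} {n} i≤d k≤n (e , n≤ , pᵉ∣x) = ℤ.∣-trans (∣-^ p k≤e) pᵉ∣x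
    where
    open ℕ.≤-Reasoning
    k≤e : k ≤ e
    k≤e = ℕ.*-cancelˡ-≤ b (ℕ.+-cancelˡ-≤ (a * (J + M)) (b * k) (b * e) (begin
      a * (J + M) + b * k  ≡⟨ sym (index≡ k) ⟩
      index k              ≤⟨ k≤n ⟩
      n                    ≤⟨ n≤ ⟩
      a * i + b * e        ≤⟨ ℕ.+-monoˡ-≤ (b * e) (ℕ.*-monoʳ-≤ a i≤d) ⟩
      a * (J + M) + b * e  ∎))

  converges : (X : ∀ {n} → Stage n → Series) →
              (∀ n → Deg< (suc (J + M)) (X (stage n))) →
              (∀ n i → Val (a * i) n (X (stage (suc n)) i ℤ.- X (stage n) i)) →
              ∀ k i → X (stage (index (suc k))) i ≡ X (stage (index k)) i [mod p ^ k ]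
  converges X X-deg X-close k i = go b
    where
    close : ∀ n → index k ≤ n → X (stage (suc n)) i ≡ X (stage n) i [mod p ^ k ]
    close n k≤n with ℕ.<-≤-connex (J + M) i
    ... | inj₁ d<i = subst₂ (_≡_[mod p ^ k ])
      (sym (X-deg (suc n) i d<i)) (sym (X-deg n i d<i)) (≡-mod-refl 0ℤ)
    ... | inj₂ i≤d = Val⇒∣ {k} i≤d k≤n (X-close n i)
    go : ∀ r → X (stage (r + index k)) i ≡ X (stage (index k)) i [mod p ^ k ]
    go zero    = ≡-mod-refl (X (stage (index k)) i)
    go (suc r) = subst (_ ℤ.∣_)
      (eq (X (stage (suc (r + index k))) i) (X (stage (r + index k)) i) (X (stage (index k)) i))
      (ℤ.∣m∣n⇒∣m+n (close (r + index k) (ℕ.m≤n+m (index k) r)) (go r))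
      where
      eq : ∀ x y z → (x ℤ.- y) ℤ.+ (y ℤ.- z) ≡ x ℤ.- z
      eq = solve-∀

  factorization : ApproxFactorization p F
  factorization = record
    { G = λ k → G (stage (index k))
    ; H = λ k → H (stage (index k))
    ; G-monic = λ k → G-monic (stage (index k))
    ; H-monic = λ k → H-monic (stage (index k))
    ; G-coherent = converges G
        (λ n i d<i → proj₂ (G-monic (stage n)) i (ℕ.≤-trans (s≤s (ℕ.m≤m+n J M)) d<i))
        (λ n → Next.G-close (step (stage n)))
    ; H-coherent = converges H
        (λ n i d<i → proj₂ (H-monic (stage n)) i (ℕ.≤-trans (s≤s (ℕ.m≤n+m M J)) d<i))
        (λ n → Next.H-close (step (stage n)))
    ; product = product
    }
    where
    product : ∀ k i → F i ≡ (H (stage (index k)) ⊛ G (stage (index k))) i [mod p ^ k ]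
    product k i = subst (_ ℤ.∣_)
      (trans (eq ((H A ⊛ G A) i) (R A i)) (cong (ℤ._- (H A ⊛ G A) i) (sym (F≗ A i)))) pᵏ∣R
      where
      A = stage (index k)
      eq : ∀ x r → r ≡ x ℤ.+ r ℤ.- x
      eq = solve-∀
      pᵏ∣R : + (p ^ k) ℤ.∣ R A i
      pᵏ∣R with ℕ.<-≤-connex i J
      ... | inj₂ J≤i = subst (_ ℤ.∣_) (sym (R-deg A i J≤i)) (∣0 _)
      ... | inj₁ i<J = Val⇒∣ {k} (ℕ.≤-trans (ℕ.<⇒≤ i<J) (ℕ.m≤m+n J M))
        (ℕ.≤-trans (ℕ.m≤n+m (index k) (a * J)) (ℕ.m≤n+m _ (b * s))) (R-val A i)

-- The Newton polygon of an irreducible polynomial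

inverse-mod : ∀ {p} → Prime p → ∀ u → ¬ (+ p ℤ.∣ u) → ∃[ u′ ] + p ℤ.∣ 1ℤ ℤ.- u ℤ.* u′
-- The sign `σ` with `∣ u ∣ = σ u` transfers the Bézout identity from `∣ u ∣` to `u`.
inverse-mod {p} pr u p∤u with ℤ.m∣∣m∣ {u} | coprime-Bézout {p} {ℤ.∣ u ∣} coprime
  where
  coprime : Coprime p ℤ.∣ u ∣
  coprime (c∣p , c∣u) with prime⇒irreducible pr c∣p
  ... | inj₁ c≡1  = c≡1
  ... | inj₂ refl = contradiction (ℤ.∣ᵤ⇒∣ c∣u) p∤u
... | ℤ.divides σ ∣u∣≡σu | Bézout.+- x y 1+y∣u∣≡xp = σ ℤ.* ℤ.- + y , ℤ.divides (+ x) (begin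
  1ℤ ℤ.- u ℤ.* (σ ℤ.* ℤ.- + y)  ≡⟨ eq u σ (+ y) ⟩
  1ℤ ℤ.+ + y ℤ.* (σ ℤ.* u)      ≡⟨ cong (λ z → 1ℤ ℤ.+ + y ℤ.* z) (sym ∣u∣≡σu) ⟩
  1ℤ ℤ.+ + y ℤ.* + ℤ.∣ u ∣      ≡⟨ cong (λ z → 1ℤ ℤ.+ z) (sym (ℤ.pos-* y ℤ.∣ u ∣)) ⟩
  + (1 + y * ℤ.∣ u ∣)           ≡⟨ cong +_ 1+y∣u∣≡xp ⟩
  + (x * p)                     ≡⟨ ℤ.pos-* x p ⟩
  + x ℤ.* + p                   ∎)
  where
  open ≡-Reasoning
  eq : ∀ u σ y → 1ℤ ℤ.- u ℤ.* (σ ℤ.* ℤ.- y) ≡ 1ℤ ℤ.+ y ℤ.* (σ ℤ.* u)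
  eq = solve-∀
... | ℤ.divides σ ∣u∣≡σu | Bézout.-+ x y 1+xp≡y∣u∣ = σ ℤ.* + y , ℤ.divides (ℤ.- + x) (begin
  1ℤ ℤ.- u ℤ.* (σ ℤ.* + y)              ≡⟨ eq u σ (+ y) ⟩
  1ℤ ℤ.- + y ℤ.* (σ ℤ.* u)              ≡⟨ cong (λ z → 1ℤ ℤ.- + y ℤ.* z) (sym ∣u∣≡σu) ⟩
  1ℤ ℤ.- + y ℤ.* + ℤ.∣ u ∣              ≡⟨ cong (λ z → 1ℤ ℤ.- z) (sym (ℤ.pos-* y ℤ.∣ u ∣)) ⟩
  1ℤ ℤ.- + (y * ℤ.∣ u ∣)                ≡⟨ cong (λ n → 1ℤ ℤ.- + n) (sym 1+xp≡y∣u∣) ⟩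
  1ℤ ℤ.- (1ℤ ℤ.+ + (x * p))             ≡⟨ cong (λ z → 1ℤ ℤ.- (1ℤ ℤ.+ z)) (ℤ.pos-* x p) ⟩
  1ℤ ℤ.- (1ℤ ℤ.+ + x ℤ.* + p)           ≡⟨ eq′ (+ x) (+ p) ⟩
  ℤ.- + x ℤ.* + p                       ∎)
  where
  open ≡-Reasoning
  eq : ∀ u σ y → 1ℤ ℤ.- u ℤ.* (σ ℤ.* y) ≡ 1ℤ ℤ.- y ℤ.* (σ ℤ.* u)
  eq = solve-∀
  eq′ : ∀ x p → 1ℤ ℤ.- (1ℤ ℤ.+ x ℤ.* p) ≡ ℤ.- x ℤ.* p
  eq′ = solve-∀

-- The search is finite: an exponent above `W` can be lowered to `W`, which meets the bound because
-- `b` is positive.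
Val? : ∀ p b .{{_ : ℕ.NonZero b}} t W x → Dec (Weight.Val p b t W x)
Val? p b t W x with ℕ.anyUpTo? (λ e → W ℕ.≤? t + b * e ×-dec + (p ^ e) ℤ.∣? x) (suc W)
... | yes (e , _ , v) = yes (e , v)
... | no  none        = no small
  where
  small : ¬ Weight.Val p b t W x
  small (e , W≤ , pᵉ∣x) with ℕ.<-≤-connex W e
  ... | inj₂ e≤W = none (e , s≤s e≤W , W≤ , pᵉ∣x)
  ... | inj₁ W<e = none (W , ℕ.≤-refl , ℕ.≤-trans (ℕ.m≤n*m W b) (ℕ.m≤n+m (b * W) t) ,
                         ℤ.∣-trans (∣-^ p (ℕ.<⇒≤ W<e)) pᵉ∣x)

module _ {p : ℕ} (pr : Prime p) {d α : ℕ} .{{d≢0 : ℕ.NonZero d}} where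

  open Weight p d

  -- The bound is raised one unit of weight at a time, and for each weight from the
  -- highest coefficient downwards: the first coefficient to fail would be a vertex of
  -- the Newton polygon, at which the polynomial factors.
  single-slope : ∀ {F} → Monic d F → + (p ^ α) ℤ.∣ F 0 → ¬ ApproxFactorization p F →
                 ∀ i → Val (α * i) (d * α) (F i)
  single-slope {F} F-monic pᵅ∣F0 irr = λ i → raise (d * α) ℕ.≤-refl i
    where
    raise : ∀ W → W ≤ d * α → ∀ i → Val (α * i) W (F i)
    raise zero    _    i = 0 , z≤n , ℤ.∣ᵤ⇒∣ (ℕ.1∣ _)
    raise (suc W) W<dα i = descend d i (ℕ.m≤n+m d i)
      where
      -- At `i = 0` the hypothesis on `F 0` gives weight `d α`. At `i > 0`, failure of the higher
      -- bound makes the weight exactly `W` and the cofactor `u` prime to `p`, as one more `p` would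
      -- add `d`. All later coefficients lie strictly above the line, so this is its last point and
      -- Hensel lifting factors `F`.
      vertex : ∀ i → i < d → Val (α * i) W (F i) → ¬ Val (α * i) (suc W) (F i) →
               ¬ (∀ k → i < k → Val (α * k) (suc W) (F k))
      vertex zero    _   _                             ¬V _      =
        ¬V (α , subst (suc W ≤_) (cong (_+ d * α) (sym (ℕ.*-zeroʳ α))) W<dα , pᵅ∣F0)
      vertex (suc j) j<d (e , W≤ , ℤ.divides u Fj≡upᵉ) ¬V higher
        with m , d≡ ← ℕ.m≤n⇒∃[o]m+o≡n j<d =
        irr (Hensel.factorization p α d j m e F
          (subst (λ n → Monic n F) (sym d≡′) F-monic)
          u (proj₁ u⁻¹) (subst (λ q → + q ℤ.∣ 1ℤ ℤ.- u ℤ.* proj₁ u⁻¹) (sym (ℕ.*-identityʳ p)) (proj₂ u⁻¹))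
          Fj≡upᵉ
          (λ k → Val-≡ refl W≡ (raise W (ℕ.<⇒≤ W<dα) k))
          (λ k j<k → Val-≡ refl (cong suc W≡) (higher k j<k)))
        where
        d≡′ : suc j + suc m ≡ d
        d≡′ = trans (ℕ.+-suc (suc j) m) d≡
        W≡ : W ≡ d * e + α * suc j
        W≡ with ℕ.m≤n⇒m<n∨m≡n W≤
        ... | inj₁ W< = contradiction (e , W< , ℤ.divides u Fj≡upᵉ) ¬V
        ... | inj₂ eq = trans eq (ℕ.+-comm (α * suc j) (d * e))
        p∤u : ¬ (+ p ℤ.∣ u)
        p∤u (ℤ.divides v refl) = ¬V (suc e ,
          ℕ.≤-trans (s≤s W≤) (ℕ.≤-trans (ℕ.≤-reflexive (sym (ℕ.+-suc (α * suc j) (d * e))))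
            (ℕ.+-monoʳ-≤ (α * suc j) (subst (suc (d * e) ≤_) (sym (ℕ.*-suc d e))
              (ℕ.+-monoˡ-≤ (d * e) (ℕ.>-nonZero⁻¹ d))))) ,
          ℤ.divides v (trans Fj≡upᵉ (trans (ℤ.*-assoc v (+ p) (+ (p ^ e)))
            (cong (λ z → v ℤ.* z) (sym (ℤ.pos-* p (p ^ e)))))))
        u⁻¹ = inverse-mod pr u p∤u
      descend : ∀ n i → d ≤ i + n → Val (α * i) (suc W) (F i)
      descend n i d≤i+n with ℕ.<-≤-connex i d
      descend n i d≤i+n | inj₂ d≤i with ℕ.m≤n⇒m<n∨m≡n d≤i
      ... | inj₁ d<i  = Val-0 (proj₂ F-monic i d<i)
      ... | inj₂ refl = 0 , ℕ.≤-trans W<dα (ℕ.≤-trans (ℕ.≤-reflexive (ℕ.*-comm d α)) (ℕ.m≤m+n (α * d) _)) ,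
                        ℤ.∣ᵤ⇒∣ (ℕ.1∣ _)
      descend zero    i d≤i+n | inj₁ i<d =
        contradiction (subst (d ≤_) (ℕ.+-identityʳ i) d≤i+n) (ℕ.<⇒≱ i<d)
      descend (suc n) i d≤i+n | inj₁ i<d with Val? p d (α * i) (suc W) (F i)
      ... | yes v = v
      ... | no ¬v = contradiction
        (λ k i<k → descend n k (ℕ.≤-trans d≤i+n
          (ℕ.≤-trans (ℕ.≤-reflexive (ℕ.+-suc i n)) (ℕ.+-monoˡ-≤ n i<k))))
        (vertex i i<d (raise W (ℕ.<⇒≤ W<dα) i) ¬v)

-- Valuations of the values

module _ {p : ℕ} (pr : Prime p) where

  private instance
    p≢0 : ℕ.NonZero p
    p≢0 = prime⇒nonZero pr

  -- The valuation as a relation: `ν` requires evidence that its argument is nonzero, which here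
  -- follows from `no-higher`.
  record ExactPower (m : ℕ) (x : ℤ) : Set where
    constructor _&_
    field
      power-divides : + (p ^ m) ℤ.∣ x
      no-higher     : ¬ (+ (p ^ suc m) ℤ.∣ x)

  open ExactPower

  Exact-1 : ExactPower 0 1ℤ
  Exact-1 = ℤ.∣-refl & λ p∣1 →
    contradiction (ℕ.∣1⇒≡1 (subst (ℕ._∣ 1) (ℕ.*-identityʳ p) (ℤ.∣⇒∣ᵤ p∣1)))
                  (ℕ.nonTrivial⇒≢1 {{prime⇒nonTrivial pr}})

  ∣-cofactor : ∀ {m q} → + (p ^ suc m) ℤ.∣ q ℤ.* + (p ^ m) → + p ℤ.∣ q
  ∣-cofactor {m} {q} pᵐ⁺¹∣qpᵐ =
    ℤ.*-cancelʳ-∣ (+ (p ^ m)) {+ p} {q} {{ℕ.m^n≢0 p m}}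
      (subst (ℤ._∣ q ℤ.* + (p ^ m)) (ℤ.pos-* p (p ^ m)) pᵐ⁺¹∣qpᵐ)

  cofactor-∣ : ∀ {m q} → + p ℤ.∣ q → + (p ^ suc m) ℤ.∣ q ℤ.* + (p ^ m)
  cofactor-∣ {m} {q} p∣q =
    subst (ℤ._∣ q ℤ.* + (p ^ m)) (sym (ℤ.pos-* p (p ^ m))) (ℤ.*-monoˡ-∣ (+ (p ^ m)) p∣q)

  -- By Euclid's lemma the product of the two cofactors is prime to `p`.
  Exact-* : ∀ {m n x y} → ExactPower m x → ExactPower n y → ExactPower (m + n) (x ℤ.* y)
  Exact-* {m} {n} (ℤ.divides q refl & ¬x) (ℤ.divides r refl & ¬y) =
    ^-*-∣ p m n (ℤ.∣n⇒∣m*n q ℤ.∣-refl) (ℤ.∣n⇒∣m*n r ℤ.∣-refl) & λ h →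
      either (euclidsLemma ℤ.∣ q ∣ ℤ.∣ r ∣ pr
        (subst (p ℕ.∣_) (ℤ.abs-* q r) (ℤ.∣⇒∣ᵤ (∣-cofactor {m + n} {q ℤ.* r} (subst (_ ℤ.∣_) regroup h)))))
    where
    eq : ∀ q r P P′ → (q ℤ.* P) ℤ.* (r ℤ.* P′) ≡ q ℤ.* r ℤ.* (P ℤ.* P′)
    eq = solve-∀
    regroup : (q ℤ.* + (p ^ m)) ℤ.* (r ℤ.* + (p ^ n)) ≡ q ℤ.* r ℤ.* + (p ^ (m + n))
    regroup = trans (eq q r (+ (p ^ m)) (+ (p ^ n))) (cong (λ z → q ℤ.* r ℤ.* z)
      (trans (sym (ℤ.pos-* (p ^ m) (p ^ n))) (cong +_ (sym (ℕ.^-distribˡ-+-* p m n)))))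
    either : ¬ (p ℕ.∣ ℤ.∣ q ∣ ⊎ p ℕ.∣ ℤ.∣ r ∣)
    either (inj₁ p∣q) = ¬x (cofactor-∣ {m} {q} (ℤ.∣ᵤ⇒∣ p∣q))
    either (inj₂ p∣r) = ¬y (cofactor-∣ {n} {r} (ℤ.∣ᵤ⇒∣ p∣r))

  Exact-^ : ∀ {m y} → ExactPower m y → ∀ n → ExactPower (n * m) (y ℤ.^ n)
  Exact-^ ex zero    = Exact-1
  Exact-^ ex (suc n) = Exact-* ex (Exact-^ ex n)

  Exact-+ : ∀ {m x y} → + (p ^ suc m) ℤ.∣ x → ExactPower m y → ExactPower m (x ℤ.+ y)
  Exact-+ {m} pᵐ⁺¹∣x (pᵐ∣y & ¬y) =
    ℤ.∣m∣n⇒∣m+n (ℤ.∣-trans (∣-^ p (ℕ.n≤1+n m)) pᵐ⁺¹∣x) pᵐ∣y & λ h → ¬y (ℤ.∣m+n∣m⇒∣n h pᵐ⁺¹∣x)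

  -- The valuation truncated at `k`, so that `y = 0` is no special case. The two outcomes match
  -- `value-near` and `value-far`.
  exact-or-divisible : ∀ k y → + (p ^ k) ℤ.∣ y ⊎ ∃[ m ] (m < k × ExactPower m y)
  exact-or-divisible zero    y = inj₁ (ℤ.∣ᵤ⇒∣ (ℕ.1∣ _))
  exact-or-divisible (suc k) y with exact-or-divisible k y | + (p ^ suc k) ℤ.∣? y
  ... | inj₂ (m , m<k , ex) | _          = inj₂ (m , ℕ.m≤n⇒m≤1+n m<k , ex)
  ... | inj₁ _              | yes pᵏ⁺¹∣y = inj₁ pᵏ⁺¹∣y
  ... | inj₁ pᵏ∣y           | no ¬pᵏ⁺¹∣y = inj₂ (k , ℕ.≤-refl , (pᵏ∣y & ¬pᵏ⁺¹∣y))

  Exact⇒ν : ∀ {m x} .{{_ : NonZero x}} → ExactPower m x → ν p x ≡ m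
  Exact⇒ν {m} {x} (pᵐ∣x & ¬pᵐ⁺¹∣x) with ℕ.<-≤-connex m (ν p x)
  ... | inj₂ ν≤m = ℕ.≤-antisym ν≤m (ν-maximal pr x (ℤ.∣⇒∣ᵤ pᵐ∣x))
  ... | inj₁ m<ν = contradiction (ℤ.∣-trans (∣-^ p m<ν) (ℤ.∣ᵤ⇒∣ (ν-divides p x))) ¬pᵐ⁺¹∣x

  ∣-power : ∀ {k y} → + (p ^ k) ℤ.∣ y → ∀ i → + (p ^ (i * k)) ℤ.∣ y ℤ.^ i
  ∣-power pᵏ∣y zero    = ℤ.∣-refl
  ∣-power {k} pᵏ∣y (suc i) = ^-*-∣ p k (i * k) pᵏ∣y (∣-power pᵏ∣y i)

  module _ {d α : ℕ} .{{d≢0 : ℕ.NonZero d}} {F : Series} (F-monic : Monic d F)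
           (F-slope : ∀ i → Weight.Val p d (α * i) (d * α) (F i)) where

    -- Term by term, with `ν(Fᵢ)` at least `e`: `d (i k + e) ≥ α i + d e ≥ d α`.
    value-near : ∀ {k y} → α ≤ d * k → + (p ^ k) ℤ.∣ y → + (p ^ α) ℤ.∣ T y (suc d) F 0
    value-near {k} {y} α≤dk pᵏ∣y =
      value-closed (+ (p ^ α) ℤ.∣_) (∣0 _) ℤ.∣m∣n⇒∣m+n y (suc d) F term
      where
      open ℕ.≤-Reasoning
      eq : ∀ d k i e → d * k * i + d * e ≡ d * (i * k + e)
      eq = ℕ-Solver.solve-∀
      term : ∀ i → i < suc d → + (p ^ α) ℤ.∣ y ℤ.^ i ℤ.* F i
      term i _ with e , dα≤ , pᵉ∣Fi ← F-slope i =
        ℤ.∣-trans (∣-^ p (ℕ.*-cancelˡ-≤ d (begin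
          d * α              ≤⟨ dα≤ ⟩
          α * i + d * e      ≤⟨ ℕ.+-monoˡ-≤ (d * e) (ℕ.*-monoˡ-≤ i α≤dk) ⟩
          d * k * i + d * e  ≡⟨ eq d k i e ⟩
          d * (i * k + e)    ∎)))
        (^-*-∣ p (i * k) e (∣-power pᵏ∣y i) pᵉ∣Fi)

    -- The leading term `y^d` has valuation `d m` and is the only one so low: for `i < d` the slope
    -- gives `d e ≥ α (d - i) > d m (d - i)`, hence `i m + e > d m`.
    value-far : ∀ {m y} → d * m < α → ExactPower m y → ExactPower (d * m) (T y (suc d) F 0)
    value-far {m} {y} dm<α ex = subst (ExactPower (d * m)) (sym (T-last y d F))
      (Exact-+ lower (subst (ExactPower (d * m))
        (sym (trans (cong (λ z → y ℤ.^ d ℤ.* z) (proj₁ F-monic)) (ℤ.*-identityʳ _))) (Exact-^ ex d)))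
      where
      open ℕ.≤-Reasoning
      eq₁ : ∀ i r α → (i + suc r) * α ≡ α * i + α * suc r
      eq₁ = ℕ-Solver.solve-∀
      eq₂ : ∀ d m r → d * (m * suc r) ≡ d * m * suc r
      eq₂ = ℕ-Solver.solve-∀
      eq₃ : ∀ i r m → (i + suc r) * m ≡ i * m + m * suc r
      eq₃ = ℕ-Solver.solve-∀
      term : ∀ i → i < d → + (p ^ suc (d * m)) ℤ.∣ y ℤ.^ i ℤ.* F i
      term i i<d with e , dα≤ , pᵉ∣Fi ← F-slope i | r , d≡ ← ℕ.m≤n⇒∃[o]m+o≡n i<d =
        ℤ.∣-trans (∣-^ p dm<im+e) (^-*-∣ p (i * m) e (∣-power (power-divides ex) i) pᵉ∣Fi)
        where
        d≡′ : d ≡ i + suc r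
        d≡′ = sym (trans (ℕ.+-suc i r) d≡)
        αr≤de : α * suc r ≤ d * e
        αr≤de = ℕ.+-cancelˡ-≤ (α * i) _ _ (begin
          α * i + α * suc r  ≡⟨ sym (eq₁ i r α) ⟩
          (i + suc r) * α    ≡⟨ cong (_* α) (sym d≡′) ⟩
          d * α              ≤⟨ dα≤ ⟩
          α * i + d * e      ∎)
        mr<e : m * suc r < e
        mr<e = ℕ.*-cancelˡ-< d _ _ (begin-strict
          d * (m * suc r)  ≡⟨ eq₂ d m r ⟩
          d * m * suc r    <⟨ ℕ.*-monoˡ-< (suc r) dm<α ⟩
          α * suc r        ≤⟨ αr≤de ⟩
          d * e            ∎)
        dm<im+e : d * m < i * m + e
        dm<im+e = begin-strict
          d * m              ≡⟨ cong (_* m) d≡′ ⟩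
          (i + suc r) * m    ≡⟨ eq₃ i r m ⟩
          i * m + m * suc r  <⟨ ℕ.+-monoʳ-< (i * m) mr<e ⟩
          i * m + e          ∎
      lower : + (p ^ suc (d * m)) ℤ.∣ T y d F 0
      lower = value-closed (+ (p ^ suc (d * m)) ℤ.∣_) (∣0 _) ℤ.∣m∣n⇒∣m+n y d F term

-- The ceiling and the minimal period

ceiling-spec : ∀ α d .{{d≢0 : ℕ.NonZero d}} → α ≤ d * ⌈ α / d ⌉ × (∀ m → m < ⌈ α / d ⌉ → d * m < α)
ceiling-spec α d@(suc d-1) = spec (ℚᵘ.ceiling (+ α ℚᵘ./ d)) α+r≡
  where
  -- The ceiling is minus the floor `z` of `- α / d`; the remainder `r < d` of that division is what
  -- rounding up adds to `α`.
  r = (ℤ.- + α) ℤ.% + d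
  z = (ℤ.- + α) ℤ./ + d
  α+r≡ : + (α + r) ≡ ℤ.- z ℤ.* + d
  α+r≡ = trans (eq (+ α) (+ r)) (trans (cong (λ t → + r ℤ.- t) (ℤ.a≡a%n+[a/n]*n (ℤ.- + α) (+ d)))
                                      (eq′ (+ r) z (+ d)))
    where
    eq : ∀ a r → a ℤ.+ r ≡ r ℤ.- ℤ.- a
    eq = solve-∀
    eq′ : ∀ r z d → r ℤ.- (r ℤ.+ z ℤ.* d) ≡ ℤ.- z ℤ.* d
    eq′ = solve-∀
  spec : ∀ w → + (α + r) ≡ w ℤ.* + d → α ≤ d * ℤ.∣ w ∣ × (∀ m → m < ℤ.∣ w ∣ → d * m < α)
  -- `α + r` is a natural number, so the quotient is not negative and the absolute value in `⌈_/_⌉`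
  -- does not alter it.
  spec ℤ.-[1+ n ] ()
  spec (+ k) α+r≡kd = ℕ.≤-trans (ℕ.m≤m+n α r) (ℕ.≤-reflexive α+r≡dk) , λ m m<k →
    ℕ.+-cancelʳ-< d _ _ (begin-strict
      d * m + d  ≡⟨ ℕ.+-comm (d * m) d ⟩
      d + d * m  ≡⟨ sym (ℕ.*-suc d m) ⟩
      d * suc m  ≤⟨ ℕ.*-monoʳ-≤ d m<k ⟩
      d * k      ≡⟨ sym α+r≡dk ⟩
      α + r      <⟨ ℕ.+-monoʳ-< α (ℤ.n%d<d (ℤ.- + α) (+ d)) ⟩
      α + d      ∎)
    where
    open ℕ.≤-Reasoning
    α+r≡dk : α + r ≡ d * k
    α+r≡dk = trans (ℤ.+-injective (trans α+r≡kd (sym (ℤ.pos-* k d)))) (ℕ.*-comm k d)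

theorem5p1 : (p : ℕ) → Prime p →
    (Q : ℤ[x]) (d : ℕ) (2≤d : 2 ≤ d) → MonicOfDegree d Q →
    IrreducibleOverℤₚ p Q →
    (α : ℕ) → IsLargest (λ β → HasRootMod Q (p ^ β)) α →
    Σ[ Q≢0 ∈ (∀ (n : ℕ) → NonZero (eval Q (+ n))) ]
    IsPeriodLength (λ n → ν p (eval Q (+ n)) {{Q≢0 n}})
    (p ^ ⌈_/_⌉ α d {{>-nonZero (<⇒≤ 2≤d)}})
theorem5p1 p pr Q d 2≤d Q-monic irr α ((x , pᵅ∣Qx) , α-max) =
  Q≢0 , (ℕ.m^n>0 p k , periodic) , minimal
  where
  instance
    p≢0 : ℕ.NonZero p
    p≢0 = prime⇒nonZero pr
    d≢0 : ℕ.NonZero d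
    d≢0 = >-nonZero (<⇒≤ 2≤d)
    pᵅ≢0 : ℕ.NonZero (p ^ α)
    pᵅ≢0 = ℕ.m^n≢0 p α

  k = ⌈ α / d ⌉

  ¬pᵅ⁺¹∣Q : ∀ y → ¬ (+ (p ^ suc α) ℤ.∣ eval Q y)
  ¬pᵅ⁺¹∣Q y h =
    ℕ.1+n≰n (α-max (suc α) (y , subst (_ ℤ.∣_) (sym (ℤ.+-identityʳ (eval Q y))) h))

  -- Zero is divisible by `p ^ suc α`, which the maximality of `α` excludes.
  Q≢0 : ∀ (n : ℕ) → NonZero (eval Q (+ n))
  Q≢0 n = ℤ.≢-nonZero λ Qn≡0 → ¬pᵅ⁺¹∣Q (+ n) (subst (_ ℤ.∣_) (sym Qn≡0) (∣0 _))

  -- The given `x` may be negative, whereas `minimal` needs a term of the sequence at which `α` is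
  -- attained. Reduction modulo `p ^ α` keeps the value divisible by `p ^ α`.
  n₀ : ℕ
  n₀ = x ℤ.%ℕ (p ^ α)

  pᵅ∣Qn₀ : + (p ^ α) ℤ.∣ eval Q (+ n₀)
  pᵅ∣Qn₀ = ∣-respects-≡ᵐ _ (eval-mod Q x≡n₀) (subst (_ ℤ.∣_) (ℤ.+-identityʳ (eval Q x)) pᵅ∣Qx)
    where
    eq : ∀ r q → r ℤ.+ q ℤ.- r ≡ q
    eq = solve-∀
    x≡n₀ : x ≡ + n₀ [mod p ^ α ]
    x≡n₀ = ℤ.divides (x ℤ./ℕ (p ^ α))
      (trans (cong (ℤ._- + n₀) (ℤ.a≡a%ℕn+[a/ℕn]*n x (p ^ α))) (eq (+ n₀) _))

  F : Series
  F = T (+ n₀) (suc d) (coeff Q)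

  F-monic : Monic d F
  F-monic = T-monic (+ n₀) Q-monic

  eval-shift : ∀ y → eval Q (+ n₀ ℤ.+ y) ≡ T y (suc d) F 0
  eval-shift y = trans (eval≡T Q (+ n₀ ℤ.+ y))
    (trans (T-size (+ n₀ ℤ.+ y) (coeff-deg Q) (proj₂ Q-monic) 0)
           (sym (T-∘ y (+ n₀) (suc d) (coeff Q) 0)))

  F-slope : ∀ i → Weight.Val p d (α * i) (d * α) (F i)
  F-slope = single-slope pr F-monic
    (subst (_ ℤ.∣_) (trans (eval≡T Q (+ n₀)) (T-size (+ n₀) (coeff-deg Q) (proj₂ Q-monic) 0)) pᵅ∣Qn₀)
    (λ fac → irreducible⇒¬factorization p pr Q irr
      (factorization-cong (T-inverse (+ n₀) (suc d) (proj₂ Q-monic))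
        (shift-factorization (ℤ.- + n₀) (suc d) (proj₂ F-monic) fac)))

  f : ℕ → ℕ
  f n = ν p (eval Q (+ n)) {{Q≢0 n}}

  f-near : ∀ n y → + n ≡ + n₀ ℤ.+ y → + (p ^ k) ℤ.∣ y → f n ≡ α
  f-near n y n≡ pᵏ∣y = Exact⇒ν pr {{Q≢0 n}}
    ( subst (_ ℤ.∣_) (sym (trans (cong (eval Q) n≡) (eval-shift y)))
        (value-near pr F-monic F-slope {k} (proj₁ (ceiling-spec α d)) pᵏ∣y)
    & ¬pᵅ⁺¹∣Q (+ n))

  f-far : ∀ n y {m} → + n ≡ + n₀ ℤ.+ y → m < k → ExactPower pr m y → f n ≡ d * m
  f-far n y {m} n≡ m<k ex = Exact⇒ν pr {{Q≢0 n}}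
    (subst (ExactPower pr (d * m)) (sym (trans (cong (eval Q) n≡) (eval-shift y)))
      (value-far pr F-monic F-slope (proj₂ (ceiling-spec α d) _ m<k) ex))

  -- Adding `p ^ k` to the distance from `n₀` preserves divisibility by `p ^ k`, and also any exact
  -- valuation `m < k`, as `p ^ suc m` divides `p ^ k`.
  periodic : ∀ n → f (n + p ^ k) ≡ f n
  periodic n = helper (exact-or-divisible pr k y)
    where
    y = + n ℤ.- + n₀
    eq : ∀ n n₀ → n ≡ n₀ ℤ.+ (n ℤ.- n₀)
    eq = solve-∀
    eq′ : ∀ n n₀ q → n ℤ.+ q ≡ n₀ ℤ.+ (q ℤ.+ (n ℤ.- n₀))
    eq′ = solve-∀
    n≡ = eq (+ n) (+ n₀)
    n+pᵏ≡ = eq′ (+ n) (+ n₀) (+ (p ^ k))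
    helper : _ → _
    helper (inj₁ pᵏ∣y) =
      trans (f-near (n + p ^ k) _ n+pᵏ≡ (ℤ.∣m∣n⇒∣m+n ℤ.∣-refl pᵏ∣y)) (sym (f-near n y n≡ pᵏ∣y))
    helper (inj₂ (m , m<k , ex)) =
      trans (f-far (n + p ^ k) _ n+pᵏ≡ m<k (Exact-+ pr (∣-^ p m<k) ex)) (sym (f-far n y n≡ m<k ex))

  -- Every period is a multiple of `p ^ k`: otherwise `S` has a valuation `m < k`, and going from
  -- `n₀` to `n₀ + S` changes the term from `α` to `d m < α`.
  minimal : ∀ S → IsPeriod f S → p ^ k ≤ S
  minimal S (1≤S , f-periodic) with exact-or-divisible pr k (+ S)
  ... | inj₁ pᵏ∣S = ℕ.∣⇒≤ {{>-nonZero 1≤S}} (ℤ.∣⇒∣ᵤ pᵏ∣S)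
  ... | inj₂ (m , m<k , ex) = contradiction
    (trans (sym (f-far (n₀ + S) (+ S) refl m<k ex))
    (trans (f-periodic n₀) (f-near n₀ 0ℤ (sym (ℤ.+-identityʳ (+ n₀))) (∣0 _))))
    (ℕ.<⇒≢ (proj₂ (ceiling-spec α d) m m<k))
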